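{- For every constant $\ell\in\mathbb{N}$ there exist a property $\mathcal{Q}^{(\ell)}$ (a family of sets $\mathcal{Q}^{(\ell)}\subseteq\{0,1\}^N$ for infinitely many input lengths $N$) and a constant $\varepsilon_1=\varepsilon_1(\ell)\in(0,1)$ such that the following two statements hold. (1) For every $\varepsilon\in(0,1)$, $\mathcal{Q}^{(\ell)}$ has an $\varepsilon$-tester whose number of queries depends only on $\varepsilon$ (and $\ell$). (2) For every $\varepsilon_0\in(0,\varepsilon_1)$, every $(\varepsilon_0,\varepsilon_1)$-tolerant tester for $\mathcal{Q}^{(\ell)}$ must make $\Omega\big(N/(10^\ell\cdot\mathrm{polylog}^{(\ell)} N)\big)$ queries on inputs of length $N$.
   Context: $\mathrm{dist}$ is relative Hamming distance. For $0\le\varepsilon_0<\varepsilon_1\le 1$, an $(\varepsilon_0,\varepsilon_1)$-testing algorithm for $\mathcal{P}\subseteq\{0,1\}^N$ is a (possibly adaptive) randomized algorithm with query access to $x\in\{0,1\}^N$ satisfying two conditions. It accepts with probability at least $2/3$ if $\mathrm{dist}(x,\mathcal{P})\le\varepsilon_0$. It rejects with probability at least $2/3$ if $\mathrm{dist}(x,\mathcal{P})>\varepsilon_1$. When $\varepsilon_0=0$ it is called an $\varepsilon_1$-tester; when $\varepsilon_0>0$ it is an $(\varepsilon_0,\varepsilon_1)$-tolerant tester. $\log^{(\ell)}$ is the $\ell$-times iterated logarithm, and $\mathrm{polylog}^{(\ell)}N=\mathrm{poly}(\log^{(\ell)}N)$.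
   Formalization: The parameters ε, ε₀, ε₁ and the constant in Ω are rational, and randomized algorithms are uniform distributions over finite multisets of decision trees, i.e. have rational probabilities. -}

module Defs where

open import Data.Bool using (Bool; true; false; if_then_else_; _≟_)
open import Data.Nat as ℕ using (ℕ; zero; suc; _+_; _^_; _⊔_)
open import Data.Nat.Logarithm using (⌊log₂_⌋)
open import Data.Fin using (Fin)
open import Data.Vec using (Vec; lookup; zipWith; foldr)
open import Data.List using (List; length; filter)
import Data.List
open import Data.List.NonEmpty using (List⁺; toList)
open import Data.Integer using (+_)
open import Data.Rational using (ℚ; _/_; _*_; _≤_; _<_; 0ℚ; 1ℚ)
open import Data.Product using (Σ; ∃; _×_; _,_)
open import Relation.Binary.PropositionalEquality using (_≡_)
open import Relation.Nullary using (¬_)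

⟦_⟧ : ℕ → ℚ
⟦ n ⟧ = + n / 1

Word : ℕ → Set
Word N = Vec Bool N

-- A property is given by: a set of admissible input lengths (which must be
-- infinite) and, for each length N, a subset of {0,1}^N (as a Boolean predicate).
record Property : Set where
  field
    defined : ℕ → Bool
    member  : (N : ℕ) → Word N → Bool
open Property public

InfinitelyManyLengths : Property → Set
InfinitelyManyLengths P = ∀ m → ∃ λ N → (m ℕ.≤ N) × (defined P N ≡ true)

xorB : Bool → Bool → Bool
xorB a b = if a then (if b then false else true) else b

hamming : ∀ {N} → Word N → Word N → ℕ
hamming x y = foldr (λ _ → ℕ) (λ b acc → (if b then 1 else 0) + acc) 0 (zipWith xorB x y)

-- dist(x, P_N) ≤ ε  (relative Hamming distance; min over the finite set P_N)
DistLE : (P : Property) (N : ℕ) → Word N → ℚ → Set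
DistLE P N x ε = ∃ λ (y : Word N) → (member P N y ≡ true) × (⟦ hamming x y ⟧ ≤ ε * ⟦ N ⟧)

-- dist(x, P_N) > ε  (vacuously true if P_N is empty, dist = ∞)
DistGT : (P : Property) (N : ℕ) → Word N → ℚ → Set
DistGT P N x ε = ∀ (y : Word N) → member P N y ≡ true → ε * ⟦ N ⟧ < ⟦ hamming x y ⟧

-- Deterministic adaptive query algorithm = decision tree querying positions of x.
data DTree (N : ℕ) : Set where
  leaf  : Bool → DTree N
  query : Fin N → DTree N → DTree N → DTree N

run : ∀ {N} → DTree N → Word N → Bool
run (leaf b) x = b
run (query i t₀ t₁) x = if lookup x i then run t₁ x else run t₀ x

depth : ∀ {N} → DTree N → ℕ
depth (leaf _) = 0
depth (query _ t₀ t₁) = suc (depth t₀ ⊔ depth t₁)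

-- A randomized adaptive algorithm: a probability distribution over decision trees,
-- given as the uniform distribution over a nonempty finite multiset of trees
-- (this captures every distribution with rational probabilities).
RandAlg : ℕ → Set
RandAlg N = List⁺ (DTree N)

queries : ∀ {N} → RandAlg N → ℕ
queries A = Data.List.foldr (λ t m → depth t ⊔ m) 0 (toList A)

#accept : ∀ {N} → RandAlg N → Word N → ℕ
#accept A x = length (filter (λ t → run t x ≟ true) (toList A))

#reject : ∀ {N} → RandAlg N → Word N → ℕ
#reject A x = length (filter (λ t → run t x ≟ false) (toList A))

AcceptsWHP : ∀ {N} → RandAlg N → Word N → Set
AcceptsWHP A x = 2 ℕ.* length (toList A) ℕ.≤ 3 ℕ.* #accept A x

RejectsWHP : ∀ {N} → RandAlg N → Word N → Set
RejectsWHP A x = 2 ℕ.* length (toList A) ℕ.≤ 3 ℕ.* #reject A x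

IsTester : (P : Property) (N : ℕ) → ℚ → ℚ → RandAlg N → Set
IsTester P N ε₀ ε₁ A =
  (∀ x → DistLE P N x ε₀ → AcceptsWHP A x) ×
  (∀ x → DistGT P N x ε₁ → RejectsWHP A x)

ilog : ℕ → ℕ → ℕ
ilog zero n = n
ilog (suc ℓ) n = ⌊log₂ ilog ℓ n ⌋

TolerantLowerBound : ℕ → Property → ℚ → ℚ → Set
TolerantLowerBound ℓ P ε₀ ε₁ =
  ∃ λ (c : ℚ) → ∃ λ (k : ℕ) → ∃ λ (N₀ : ℕ) →
    (0ℚ < c) ×
    (∀ N → N₀ ℕ.≤ N → defined P N ≡ true → (A : RandAlg N) → IsTester P N ε₀ ε₁ A →
       c * ⟦ N ⟧ ≤ ⟦ queries A ℕ.* (10 ^ ℓ) ℕ.* ((ilog ℓ N + 2) ^ k) ⟧)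

{-# OPTIONS --safe #-}
module Submission where

-- The property: the first n of the N bits are free, and each remaining bit must equal the
-- parity of four prescribed free bits ("row" p).  Recomputing the bound bits from the free ones
-- shows that a word ε-far from the property violates more than an ε fraction of the rows, so
-- testing O(1/ε) random rows suffices.
--
-- Suppose any q rows are linearly independent, and let G ζ be the bound bits computed from ζ.
-- Erase the free bits.  For uniform ζ, any q bits of G ζ are uniform, so q queries cannot tell
-- G ζ from w + G ζ, for any fixed w.  The former is n-close to the property, and for a w far
-- from all G ζ the latter is far from it.  Here n ≈ N / log⁽ℓ⁺¹⁾ N = o(N), and a union bound
-- over the dependent sets of rows gives a choice of rows with q ≈ n² / (32 N).

open import Defs
open import Data.Bool using (Bool; true; false; not; _xor_; _∧_; if_then_else_)
import Data.Bool as Bool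
open import Data.Bool.Properties
  using (not-involutive; xor-assoc; xor-comm; xor-identityʳ; xor-same; not-distribˡ-xor;
        not-distribʳ-xor; ∧-zeroʳ; ∧-comm; ∧-identityʳ; ∧-distribʳ-xor; T-≡)
open import Data.Nat as ℕ
  using (ℕ; zero; suc; pred; _+_; _*_; _^_; _∸_; _⊔_; _/_; _%_; _≤_; _<_; _≤?_; _<?_; _<ᵇ_;
        _≡ᵇ_; z≤n; s≤s; NonZero; >-nonZero)
open import Data.Nat.Properties
open import Data.Nat.Combinatorics using (_C_; nCk≡nC[n∸k]; nCn≡1; nCk+nC[k+1]≡[n+1]C[k+1])
open import Data.Nat.Coprimality using (Coprime)
open import Data.Nat.DivMod using (m/n*n≤m; m*n/n≡m; /-monoˡ-≤; m/n<m; m%n<n; m≡m%n+[m/n]*n)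
open import Data.Nat.ListAction using (sum)
open import Data.Nat.ListAction.Properties using (sum-++)
open import Data.Nat.Logarithm using (⌊log₂_⌋; ⌊log₂⌋-mono-≤; ⌊log₂[2^n]⌋≡n)
open import Data.Nat.Tactic.RingSolver using (solve-∀)
open import Data.Fin using (Fin; zero; suc; toℕ; inject≤; fromℕ<)
import Data.Fin as Fin
open import Data.Fin.Properties using (toℕ-inject≤; toℕ-fromℕ<; toℕ<n; toℕ-injective)
open import Data.Integer using (-[1+_]; +≤+; +<+)
import Data.Integer as ℤ
import Data.Integer.Properties as ℤ
open import Data.Rational using (ℚ; mkℚ; 0ℚ; 1ℚ; toℚᵘ; *<*)
import Data.Rational as ℚ
import Data.Rational.Properties as ℚ
open import Data.Rational.Unnormalised using (mkℚᵘ)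
import Data.Rational.Unnormalised as ℚᵘ
import Data.Rational.Unnormalised.Properties as ℚᵘ
open import Data.List
  using (List; []; _∷_; _++_; map; length; allFin; upTo; cartesianProductWith; filter)
import Data.List as List
open import Data.List.NonEmpty using (List⁺; _∷_; toList)
open import Data.List.Properties
  using (map-++; map-∘; map-cong; map-tabulate; length-tabulate; length-map; length-++; upTo-∷ʳ)
open import Data.List.Relation.Unary.All using (All; []; _∷_)
import Data.List.Relation.Unary.All as All
import Data.List.Relation.Unary.All.Properties as All
open import Data.Vec using (Vec; []; _∷_; lookup; zipWith; replicate; tabulate; updateAt)
import Data.Vec as Vec
open import Data.Vec.Properties
  using (updateAt-updateAt; updateAt-id-local; updateAt-commutes; lookup∘updateAt;
        lookup∘updateAt′; lookup-replicate; lookup-map; lookup-zipWith; lookup∘tabulate;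
        tabulate-cong; tabulate∘lookup; length-toList; ∷-injective)
open import Data.Product using (∃; _×_; _,_; proj₁; proj₂)
open import Data.Sum using (_⊎_; inj₁; inj₂)
open import Data.Empty using (⊥)
open import Function using (_∘_; id; _⟨_⟩_; Equivalence)
open import Relation.Nullary using (Dec; yes; no; contradiction; does)
open import Relation.Binary.PropositionalEquality

-- Two demands on n collide. Erasing the free bits must cost at most ε₀N for every constant ε₀ > 0,
-- which forces n/N to tend to 0; but this choice of rows yields independence only up to order n²/N,
-- so n/N may decay only slowly. With n about N / ratio the query bound is about N / (32 ratio²),
-- whence the constant 1/32 and the exponent 2 of the polylogarithm.
--
-- Four bits per row come from the count. A set of w random rows sums to zero when a random walk of
-- 4w steps on the hypercube returns to its start. This has probability at most (4w/n)^(2w), against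
-- at most N^w / w! sets, so the product decays geometrically while w is a small fraction of n²/N.
-- Rows of two bits would be edges of a graph with far more edges than vertices, and its cycles of
-- logarithmic length would be dependent sets.

private variable
  A B D   : Set
  n r k N : ℕ

-- Finite sums over lists and vectors

⟪_⟫ : Bool → ℕ
⟪ b ⟫ = if b then 1 else 0

∑ : List A → (A → ℕ) → ℕ
∑ xs g = sum (map g xs)

infix 5 ∑
syntax ∑ xs (λ x → e) = ∑[ x ∈ xs ] e

∑-cong : (xs : List A) {g h : A → ℕ} → (∀ x → g x ≡ h x) → ∑ xs g ≡ ∑ xs h
∑-cong xs eq = cong sum (map-cong eq xs)

∑-mono : (xs : List A) {g h : A → ℕ} → (∀ x → g x ≤ h x) → ∑ xs g ≤ ∑ xs h
∑-mono []       le = z≤n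
∑-mono (x ∷ xs) le = +-mono-≤ (le x) (∑-mono xs le)

∑-+ : (xs : List A) (g h : A → ℕ) → ∑[ x ∈ xs ] (g x + h x) ≡ ∑ xs g + ∑ xs h
∑-+ []       g h = refl
∑-+ (x ∷ xs) g h = trans (cong (g x + h x +_) (∑-+ xs g h)) (interchange (g x) (h x) _ _)
  where
  interchange : ∀ a b c d → a + b + (c + d) ≡ a + c + (b + d)
  interchange = solve-∀

∑-*ˡ : ∀ c (xs : List A) (g : A → ℕ) → ∑[ x ∈ xs ] (c * g x) ≡ c * ∑ xs g
∑-*ˡ c []       g = sym (*-zeroʳ c)
∑-*ˡ c (x ∷ xs) g = trans (cong (c * g x +_) (∑-*ˡ c xs g)) (sym (*-distribˡ-+ c (g x) _))

∑-*ʳ : ∀ c (xs : List A) (g : A → ℕ) → ∑[ x ∈ xs ] (g x * c) ≡ ∑ xs g * c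
∑-*ʳ c xs g = trans (∑-cong xs λ x → *-comm (g x) c) (trans (∑-*ˡ c xs g) (*-comm c _))

∑-const : ∀ c (xs : List A) → ∑[ _ ∈ xs ] c ≡ length xs * c
∑-const c []       = refl
∑-const c (x ∷ xs) = cong (c +_) (∑-const c xs)

∑-swap : (xs : List A) (ys : List B) (g : A → B → ℕ) →
         ∑[ x ∈ xs ] ∑[ y ∈ ys ] g x y ≡ ∑[ y ∈ ys ] ∑[ x ∈ xs ] g x y
∑-swap []       ys g = sym (trans (∑-const 0 ys) (*-zeroʳ (length ys)))
∑-swap (x ∷ xs) ys g = trans (cong (∑ ys (g x) +_) (∑-swap xs ys g)) (sym (∑-+ ys (g x) _))

∑-cartesianProductWith : (f : A → B → D) (xs : List A) (ys : List B) (g : D → ℕ) →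
  ∑ (cartesianProductWith f xs ys) g ≡ ∑[ x ∈ xs ] ∑[ y ∈ ys ] g (f x y)
∑-cartesianProductWith f []       ys g = refl
∑-cartesianProductWith f (x ∷ xs) ys g = begin
  sum (map g (map (f x) ys ++ rest))                ≡⟨ cong sum (map-++ g (map (f x) ys) rest) ⟩
  sum (map g (map (f x) ys) ++ map g rest)          ≡⟨ sum-++ (map g (map (f x) ys)) _ ⟩
  sum (map g (map (f x) ys)) + sum (map g rest)
    ≡⟨ cong₂ _+_ (cong sum (sym (map-∘ ys))) (∑-cartesianProductWith f xs ys g) ⟩
  ∑ ys (g ∘ f x) + (∑[ x′ ∈ xs ] ∑[ y ∈ ys ] g (f x′ y)) ∎
  where
  open ≡-Reasoning
  rest = cartesianProductWith f xs ys

-- First-moment method, run as a search through the list so that the witness is obtained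
-- constructively.
∑-average : (xs : List A) (g : A → ℕ) {m : ℕ} → ∑ xs g < length xs * m → ∃ λ x → g x < m
∑-average (x ∷ xs) g {m} lt with g x <? m
... | yes gx<m = x , gx<m
... | no  gx≮m = ∑-average xs g (+-cancelˡ-< m _ _ (≤-<-trans (+-monoˡ-≤ _ (≮⇒≥ gx≮m)) lt))

∑-zero : (xs : List A) {g : A → ℕ} → (∀ x → g x ≡ 0) → ∑ xs g ≡ 0
∑-zero xs {g} g≡0 = trans (∑-cong xs g≡0) (trans (∑-const 0 xs) (*-zeroʳ (length xs)))

∑-allFin : (g : Fin (suc n) → ℕ) → ∑ (allFin (suc n)) g ≡ g zero + ∑ (allFin n) (g ∘ suc)
∑-allFin {n} g = cong (λ l → g zero + sum l)
    (trans (map-tabulate suc g) (sym (map-tabulate id (g ∘ suc))))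

∑-single : (i : Fin n) (c : ℕ) → ∑[ j ∈ allFin n ] ⟪ does (j Fin.≟ i) ⟫ * c ≡ c
∑-single {suc n} zero c = trans (∑-allFin {n} _)
  (trans (cong (c + 0 +_) (∑-zero (allFin n) λ _ → refl)) (trans (+-identityʳ _) (+-identityʳ c)))
∑-single {suc n} (suc i) c = trans (∑-allFin {n} λ j → ⟪ does (j Fin.≟ suc i) ⟫ * c) (∑-single i c)

≤-∑ : (g : Fin n → ℕ) (i : Fin n) → g i ≤ ∑ (allFin n) g
≤-∑ {suc n} g zero = ≤-trans (m≤m+n (g zero) _) (≤-reflexive (sym (∑-allFin {n} g)))
≤-∑ {suc n} g (suc i) =
  ≤-trans (≤-trans (≤-∑ (g ∘ suc) i) (m≤n+m _ (g zero))) (≤-reflexive (sym (∑-allFin {n} g)))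

vecs : List A → (k : ℕ) → List (Vec A k)
vecs xs zero    = [] ∷ []
vecs xs (suc k) = cartesianProductWith _∷_ xs (vecs xs k)

∑-vecs : (xs : List A) (k : ℕ) (g : Vec A (suc k) → ℕ) →
         ∑ (vecs xs (suc k)) g ≡ ∑[ x ∈ xs ] ∑[ v ∈ vecs xs k ] g (x ∷ v)
∑-vecs xs k g = ∑-cartesianProductWith _∷_ xs (vecs xs k) g

length-cartesianProductWith : (f : A → B → D) (xs : List A) (ys : List B) →
  length (cartesianProductWith f xs ys) ≡ length xs * length ys
length-cartesianProductWith f []       ys = refl
length-cartesianProductWith f (x ∷ xs) ys = trans (length-++ (map (f x) ys))
  (cong₂ _+_ (length-map (f x) ys) (length-cartesianProductWith f xs ys))

length-vecs : (xs : List A) (k : ℕ) → length (vecs xs k) ≡ length xs ^ k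
length-vecs xs zero    = refl
length-vecs xs (suc k) =
  trans (length-cartesianProductWith _∷_ xs (vecs xs k)) (cong (length xs *_) (length-vecs xs k))

-- Counting dependent sets of rows

toggle : Fin n → Vec Bool n → Vec Bool n
toggle i v = updateAt v i not

toggles : Vec (Fin n) r → Vec Bool n → Vec Bool n
toggles []       v = v
toggles (i ∷ is) v = toggles is (toggle i v)

toggle-involutive : (i : Fin n) (v : Vec Bool n) → toggle i (toggle i v) ≡ v
toggle-involutive i v = trans (updateAt-updateAt i v) (updateAt-id-local i v (not-involutive _))

isZero : Vec Bool n → Bool
isZero []      = true
isZero (b ∷ v) = not b ∧ isZero v

isZero-lookup : (i : Fin n) (v : Vec Bool n) → lookup v i ≡ true → isZero v ≡ false
isZero-lookup zero    (true ∷ v) eq = refl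
isZero-lookup (suc i) (b ∷ v)    eq = trans (cong (not b ∧_) (isZero-lookup i v eq)) (∧-zeroʳ (not b))

-- paths v s counts the walks of length s from v to 0 in the hypercube.
paths : Vec Bool n → ℕ → ℕ
paths v zero = ⟪ isZero v ⟫
paths {n} v (suc s) = ∑[ i ∈ allFin n ] paths (toggle i v) s

-- A row, repetitions allowed, acts as four successive steps of a walk; this splits the first `k`
-- steps off.
∑-paths : ∀ k s (v : Vec Bool n) →
          ∑[ is ∈ vecs (allFin n) k ] paths (toggles is v) s ≡ paths v (k + s)
∑-paths zero    s v = +-identityʳ _
∑-paths {n} (suc k) s v =
  trans (∑-vecs (allFin n) k _) (∑-cong (allFin n) λ i → ∑-paths k s (toggle i v))

-- A walk from v + e_i to 0 with v_i = 0 must use i; delete the first such step.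
paths-toggle : ∀ s (i : Fin n) v → lookup v i ≡ false → paths (toggle i v) (suc s) ≤ suc s * paths v s
paths-toggle {n} s i v vi = begin
  (∑[ j ∈ allFin n ] paths (toggle j (toggle i v)) s)
    ≤⟨ ∑-mono (allFin n) (step s) ⟩
  (∑[ j ∈ allFin n ] (⟪ does (j Fin.≟ i) ⟫ * paths v s + rest s j))
    ≡⟨ ∑-+ (allFin n) _ _ ⟩
  (∑[ j ∈ allFin n ] ⟪ does (j Fin.≟ i) ⟫ * paths v s) + ∑ (allFin n) (rest s)
    ≡⟨ cong₂ _+_ (∑-single i (paths v s)) (∑-rest s) ⟩
  paths v s + s * paths v s ∎
  where
  open ≤-Reasoning
  rest : ℕ → Fin n → ℕ
  rest zero    j = 0
  rest (suc s) j = suc s * paths (toggle j v) s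
  ∑-rest : ∀ s → ∑ (allFin n) (rest s) ≡ s * paths v s
  ∑-rest zero    = ∑-zero (allFin n) λ _ → refl
  ∑-rest (suc s) = ∑-*ˡ (suc s) (allFin n) _
  step : ∀ s j → paths (toggle j (toggle i v)) s ≤ ⟪ does (j Fin.≟ i) ⟫ * paths v s + rest s j
  step s j with j Fin.≟ i
  ... | yes refl = ≤-trans (≤-reflexive
      (trans (cong (λ u → paths u s) (toggle-involutive i v)) (sym (+-identityʳ _))))
          (m≤m+n _ (rest s j))
  -- No step remains after `j`, and coordinate `i` is still set, so the walk has not reached zero.
  step zero j | no j≢i = ≤-reflexive (cong ⟪_⟫ (isZero-lookup i (toggle j (toggle i v))
    (trans (lookup∘updateAt′ i j (j≢i ∘ sym) (toggle i v))
        (trans (lookup∘updateAt i v) (cong not vi)))))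
  step (suc s) j | no j≢i =
      ≤-trans (≤-reflexive (cong (λ u → paths u (suc s)) (updateAt-commutes j i j≢i v)))
    (paths-toggle s i (toggle j v) (trans (lookup∘updateAt′ i j (j≢i ∘ sym) v) vi))

𝟘 : Vec Bool n
𝟘 = replicate _ false

-- After the first step one coordinate is set, and one of the `suc s` remaining steps must clear it.
-- Iterating gives the bound n^m (2m-1)!! on closed walks of 2m steps: the number of perfect
-- matchings of the steps, times a coordinate for each pair.
closed-paths : ∀ s → paths {n} 𝟘 (2 + s) ≤ n * (suc s * paths {n} 𝟘 s)
closed-paths {n} s = begin
  (∑[ i ∈ allFin n ] paths (toggle i 𝟘) (suc s))
    ≤⟨ ∑-mono (allFin n) (λ i → paths-toggle s i 𝟘 (lookup-replicate i false)) ⟩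
  (∑[ i ∈ allFin n ] suc s * paths {n} 𝟘 s)      ≡⟨ ∑-const _ (allFin n) ⟩
  length (allFin n) * (suc s * paths {n} 𝟘 s)
    ≡⟨ cong (_* (suc s * paths {n} 𝟘 s)) (length-tabulate {n = n} id) ⟩
  n * (suc s * paths {n} 𝟘 s) ∎
  where open ≤-Reasoning

nC0≡1 : ∀ n → n C 0 ≡ 1
nC0≡1 n = trans (nCk≡nC[n∸k] {0} {n} z≤n) (nCn≡1 n)

-- The exact factor on the right is n - k; weakening it to `n` avoids truncated subtraction and
-- still gives n^k / k! when iterated.
[1+k]*nC[1+k]≤n*nCk : ∀ n k → suc k * (n C suc k) ≤ n * (n C k)
[1+k]*nC[1+k]≤n*nCk zero    k       = ≤-reflexive (*-zeroʳ (suc k))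
[1+k]*nC[1+k]≤n*nCk (suc n) zero    rewrite sym (nCk+nC[k+1]≡[n+1]C[k+1] n 0) | nC0≡1 n | nC0≡1 (suc n)
  = s≤s (≤-trans (≤-trans ([1+k]*nC[1+k]≤n*nCk n 0) (≤-reflexive (cong (n *_) (nC0≡1 n)))) ≤-refl)
[1+k]*nC[1+k]≤n*nCk (suc n) (suc k) = begin
  suc (suc k) * (suc n C suc (suc k))
    ≡⟨ cong (suc (suc k) *_) (sym (nCk+nC[k+1]≡[n+1]C[k+1] n (suc k))) ⟩
  suc (suc k) * (b + n C suc (suc k))                 ≡⟨ *-distribˡ-+ (suc (suc k)) b _ ⟩
  suc (suc k) * b + suc (suc k) * (n C suc (suc k))
    ≤⟨ +-monoʳ-≤ (suc (suc k) * b) ([1+k]*nC[1+k]≤n*nCk n (suc k)) ⟩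
  (b + suc k * b) + n * b
    ≤⟨ +-monoˡ-≤ (n * b) (+-monoʳ-≤ b ([1+k]*nC[1+k]≤n*nCk n k)) ⟩
  (b + n * a) + n * b                                 ≤⟨ m≤n+m _ a ⟩
  a + ((b + n * a) + n * b)                           ≡⟨ regroup n a b ⟩
  suc n * (a + b)
    ≡⟨ cong (suc n *_) (nCk+nC[k+1]≡[n+1]C[k+1] n k) ⟩
  suc n * (suc n C suc k) ∎
  where
  open ≤-Reasoning
  a = n C k
  b = n C suc k
  regroup : ∀ n a b → a + ((b + n * a) + n * b) ≡ suc n * (a + b)
  regroup = solve-∀

Row : ℕ → Set
Row n = Vec (Fin n) 4

rows : (n : ℕ) → List (Row n)
rows n = vecs (allFin n) 4

systems : (n N : ℕ) → List (Vec (Row n) N)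
systems n N = vecs (rows n) N

-- The number of w-element sets of rows of f whose sum is v.
sets : ∀ {N} → Vec Bool n → Vec (Row n) N → ℕ → ℕ
sets v []      zero    = ⟪ isZero v ⟫
sets v []      (suc w) = 0
sets v (r ∷ f) zero    = sets v f zero
sets v (r ∷ f) (suc w) = sets v f (suc w) + sets (toggles r v) f w

-- Linearity of expectation: each of the `N C w` sets of positions holds w independent uniform rows,
-- whose sum is a walk of 4w steps. The factor `R ^ w` on the left takes the place of a division on
-- the right.
∑-sets : ∀ N w (v : Vec Bool n) → let R = length (rows n) in
  (∑[ f ∈ systems n N ] sets v f w) * R ^ w ≡ (N C w) * R ^ N * paths v (w * 4)
∑-sets zero zero v = cong (_* 1) (+-identityʳ ⟪ isZero v ⟫) ⟨ trans ⟩ trans (*-identityʳ _)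
    (sym (+-identityʳ _))
∑-sets zero (suc w) v = refl
∑-sets {n} (suc N) zero v = begin
  (∑[ f ∈ systems n (suc N) ] sets v f 0) * 1              ≡⟨ *-identityʳ _ ⟩
  (∑[ f ∈ systems n (suc N) ] sets v f 0)                  ≡⟨ ∑-vecs (rows n) N _ ⟩
  (∑[ r ∈ rows n ] ∑[ f ∈ systems n N ] sets v f 0)        ≡⟨ ∑-const _ (rows n) ⟩
  R * (∑[ f ∈ systems n N ] sets v f 0)
    ≡⟨ cong (R *_) (trans (sym (*-identityʳ _)) (∑-sets N 0 v)) ⟩
  R * ((N C 0) * R ^ N * p)
    ≡⟨ cong (λ c → R * (c * R ^ N * p)) (nC0≡1 N) ⟩
  R * (1 * R ^ N * p)                                      ≡⟨ regroup R (R ^ N) p ⟩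
  1 * (R * R ^ N) * p
    ≡⟨ cong (λ c → c * (R * R ^ N) * p) (sym (nC0≡1 (suc N))) ⟩
  (suc N C 0) * R ^ suc N * p ∎
  where
  open ≡-Reasoning
  R = length (rows n)
  p = paths v 0
  regroup : ∀ a b c → a * (1 * b * c) ≡ 1 * (a * b) * c
  regroup = solve-∀
∑-sets {n} (suc N) (suc w) v = begin
  (∑[ f ∈ systems n (suc N) ] sets v f (suc w)) * R ^ suc w
    ≡⟨ cong (_* R ^ suc w) (∑-vecs (rows n) N _) ⟩
  (∑[ r ∈ rows n ] ∑[ f ∈ systems n N ] (sets v f (suc w) + sets (toggles r v) f w)) * R ^ suc w
    ≡⟨ cong (_* R ^ suc w) (trans (∑-cong (rows n) λ r → ∑-+ (systems n N) _ _) (∑-+ (rows n) _ _)) ⟩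
  ((∑[ r ∈ rows n ] S v (suc w)) + (∑[ r ∈ rows n ] S (toggles r v) w)) * R ^ suc w
    ≡⟨ cong (λ c → (c + T) * R ^ suc w) (∑-const _ (rows n)) ⟩
  (R * S v (suc w) + T) * (R * R ^ w)
    ≡⟨ distribute R (S v (suc w)) T (R ^ w) ⟩
  R * (S v (suc w) * (R * R ^ w)) + R * (T * R ^ w)
    ≡⟨ cong₂ (λ c d → R * c + R * d) (∑-sets N (suc w) v) T-eq ⟩
  R * ((N C suc w) * R ^ N * p) + R * ((N C w) * R ^ N * p)
    ≡⟨ collect R (N C suc w) (N C w) (R ^ N) p ⟩
  ((N C w) + (N C suc w)) * (R * R ^ N) * p
    ≡⟨ cong (λ c → c * (R * R ^ N) * p) (nCk+nC[k+1]≡[n+1]C[k+1] N w) ⟩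
  (suc N C suc w) * R ^ suc N * p ∎
  where
  open ≡-Reasoning
  R = length (rows n)
  p = paths v (suc w * 4)
  S : Vec Bool n → ℕ → ℕ
  S u k = ∑[ f ∈ systems n N ] sets u f k
  T = ∑[ r ∈ rows n ] S (toggles r v) w
  T-eq : T * R ^ w ≡ (N C w) * R ^ N * p
  T-eq = begin
    T * R ^ w
      ≡⟨ sym (∑-*ʳ (R ^ w) (rows n) _) ⟩
    (∑[ r ∈ rows n ] S (toggles r v) w * R ^ w)
      ≡⟨ ∑-cong (rows n) (λ r → ∑-sets N w (toggles r v)) ⟩
    (∑[ r ∈ rows n ] (N C w) * R ^ N * paths (toggles r v) (w * 4))
      ≡⟨ ∑-*ˡ ((N C w) * R ^ N) (rows n) _ ⟩
    (N C w) * R ^ N * (∑[ r ∈ rows n ] paths (toggles r v) (w * 4))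
      ≡⟨ cong ((N C w) * R ^ N *_) (∑-paths 4 (w * 4) v) ⟩
    (N C w) * R ^ N * p ∎
  distribute : ∀ R s t q → (R * s + t) * (R * q) ≡ R * (s * (R * q)) + R * (t * q)
  distribute = solve-∀
  collect : ∀ R a b q p → R * (a * q * p) + R * (b * q * p) ≡ (b + a) * (R * q) * p
  collect = solve-∀

length-rows : ∀ n → length (rows n) ≡ n ^ 4
length-rows n = trans (length-vecs (allFin n) 4) (cong (_^ 4) (length-tabulate {n = n} id))

-- From w to w+1 the binomial grows by at most N/(w+1), the walk count by at most (4(w+1)n)², and
-- the power of two by 2. Together this is 32N(w+1)n², at most n⁴ by hypothesis: the origin of the
-- 32.
dependency-bound : ∀ n N w → 32 * N * w ≤ n * n →
  (N C w) * paths {n} 𝟘 (w * 4) * 2 ^ w ≤ (n ^ 4) ^ w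
dependency-bound n N zero    _  rewrite nC0≡1 N = ≤-trans (≤-reflexive (simp _)) (ind (isZero {n} 𝟘))
  where
  simp : ∀ x → 1 * x * 1 ≡ x
  simp = solve-∀
  ind : ∀ b → ⟪ b ⟫ ≤ 1
  ind true  = ≤-refl
  ind false = z≤n
dependency-bound n N (suc w) le = *-cancelˡ-≤ (suc w) (begin
  suc w * ((N C suc w) * P′ * (2 * 2 ^ w))                ≡⟨ front (suc w) (N C suc w) P′ (2 ^ w) ⟩
  (suc w * (N C suc w)) * P′ * (2 * 2 ^ w)
    ≤⟨ *-monoˡ-≤ (2 * 2 ^ w) (*-mono-≤ ([1+k]*nC[1+k]≤n*nCk N w) P′≤) ⟩
  (N * c) * (n * (4 * suc w * (n * (4 * suc w * P)))) * (2 * 2 ^ w)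
    ≡⟨ regroup N c n (suc w) P (2 ^ w) ⟩
  (32 * N * suc w) * (suc w * (n * n)) * (c * P * 2 ^ w)
    ≤⟨ *-mono-≤ (*-monoˡ-≤ (suc w * (n * n)) le)
        (dependency-bound n N w (≤-trans (*-monoʳ-≤ (32 * N) (n≤1+n w)) le)) ⟩
  (n * n) * (suc w * (n * n)) * (n ^ 4) ^ w               ≡⟨ back n (suc w) ((n ^ 4) ^ w) ⟩
  suc w * (n ^ 4 * (n ^ 4) ^ w) ∎)
  where
  open ≤-Reasoning
  c = N C w
  P = paths {n} 𝟘 (w * 4)
  P′ = paths {n} 𝟘 (suc w * 4)
  three : 3 + w * 4 ≤ 4 * suc w
  three = ≤-trans (n≤1+n _) (≤-reflexive (*-comm (suc w) 4))
  one : 1 + w * 4 ≤ 4 * suc w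
  one = ≤-trans (≤-trans (n≤1+n _) (n≤1+n _)) three
  P′≤ : P′ ≤ n * (4 * suc w * (n * (4 * suc w * P)))
  P′≤ = ≤-trans (closed-paths {n} (2 + w * 4)) (*-monoʳ-≤ n (*-mono-≤ three
          (≤-trans (closed-paths {n} (w * 4)) (*-monoʳ-≤ n (*-monoˡ-≤ P one)))))
  front : ∀ s a p q → s * (a * p * (2 * q)) ≡ (s * a) * p * (2 * q)
  front = solve-∀
  regroup : ∀ N c n s p q → (N * c) * (n * (4 * s * (n * (4 * s * p)))) * (2 * q) ≡
      (32 * N * s) * (s * (n * n)) * (c * p * q)
  regroup = solve-∀
  back : ∀ n s q → (n * n) * (s * (n * n)) * q ≡ s * (n * (n * (n * (n * 1))) * q)
  back = solve-∀

∑-upTo : ∀ (u : ℕ → ℕ) d → ∑ (upTo (suc d)) u ≡ ∑ (upTo d) u + u d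
∑-upTo u d = trans (cong (λ l → sum (map u l)) (sym (upTo-∷ʳ d)))
  (trans (cong sum (map-++ u (upTo d) (d ∷ [])))
      (trans (sum-++ (map u (upTo d)) _) (cong (∑ (upTo d) u +_) (+-identityʳ _))))

-- The subtraction-free form of u₁ + … + u_d ≤ (1 − 2⁻ᵈ) M; here u w stands for u_{w+1}.
∑-geometric : ∀ (u : ℕ → ℕ) M d → (∀ w → suc w ≤ d → u w * 2 ^ suc w ≤ M) →
    2 ^ d * ∑ (upTo d) u + M ≤ 2 ^ d * M
∑-geometric u M zero    _  = ≤-reflexive (sym (+-identityʳ M))
∑-geometric u M (suc d) le = begin
  2 * 2 ^ d * ∑ (upTo (suc d)) u + M           ≡⟨ cong (λ s → 2 * 2 ^ d * s + M) (∑-upTo u d) ⟩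
  2 * 2 ^ d * (∑ (upTo d) u + u d) + M         ≡⟨ expand (2 ^ d) (∑ (upTo d) u) (u d) M ⟩
  2 * (2 ^ d * ∑ (upTo d) u) + M + u d * (2 * 2 ^ d)
    ≤⟨ +-monoʳ-≤ (2 * (2 ^ d * ∑ (upTo d) u) + M) (le d ≤-refl) ⟩
  2 * (2 ^ d * ∑ (upTo d) u) + M + M           ≡⟨ double (2 ^ d * ∑ (upTo d) u) M ⟩
  2 * (2 ^ d * ∑ (upTo d) u + M)
    ≤⟨ *-monoʳ-≤ 2 (∑-geometric u M d (λ w w<d → le w (≤-trans w<d (n≤1+n d)))) ⟩
  2 * (2 ^ d * M)                              ≡⟨ sym (*-assoc 2 (2 ^ d) M) ⟩
  2 * 2 ^ d * M ∎
  where
  open ≤-Reasoning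
  expand : ∀ q s x M → 2 * q * (s + x) + M ≡ 2 * (q * s) + M + x * (2 * q)
  expand = solve-∀
  double : ∀ x M → 2 * x + M + M ≡ 2 * (x + M)
  double = solve-∀

∑-average-vecs : (xs : List A) (N : ℕ) (g : Vec A N → ℕ) →
    ∑ (vecs xs N) g < length xs ^ N → ∃ λ f → g f ≡ 0
∑-average-vecs xs N g lt
  with f , gf<1 ← ∑-average (vecs xs N) g {1}
         (subst (∑ (vecs xs N) g <_) (sym (trans (*-identityʳ _) (length-vecs xs N))) lt)
  = f , n<1⇒n≡0 gf<1

∑-upTo-zero : ∀ (u : ℕ → ℕ) d → ∑ (upTo d) u ≡ 0 → ∀ w → w < d → u w ≡ 0
∑-upTo-zero u (suc d) eq w (s≤s w≤d) with sum≡0 ← trans (sym (∑-upTo u d)) eq | m≤n⇒m<n∨m≡n w≤d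
... | inj₁ w<d  = ∑-upTo-zero u d (m+n≡0⇒m≡0 _ sum≡0) w w<d
... | inj₂ refl = m+n≡0⇒n≡0 (∑ (upTo d) u) sum≡0

-- Union bound: dependent sets of size w number at most a 2⁻ʷ fraction of all systems on total, so
-- over all admissible sizes their average number per system is below one, and some system has none.
independent-rows-exist : ∀ n N .{{_ : NonZero n}} .{{_ : NonZero N}} →
  ∃ λ (f : Vec (Row n) N) → ∀ w → 32 * N * suc w ≤ n * n → sets 𝟘 f (suc w) ≡ 0
independent-rows-exist n N = f , λ w le → ∑-upTo-zero (λ w → sets 𝟘 f (suc w)) d f-good w
  (below w le)
  where
  instance
    32N≢0 : NonZero (32 * N)
    32N≢0 = m*n≢0 32 N
    n⁴≢0 : NonZero (n ^ 4)
    n⁴≢0 = m^n≢0 n 4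
  d = n * n / (32 * N)
  below : ∀ w → 32 * N * suc w ≤ n * n → suc w ≤ d
  below w le = ≤-trans (≤-reflexive (sym (m*n/n≡m (suc w) (32 * N))))
      (/-monoˡ-≤ (32 * N) (≤-trans (≤-reflexive (*-comm (suc w) (32 * N))) le))
  S : ℕ → ℕ
  S w = ∑[ f ∈ systems n N ] sets 𝟘 f w
  R = n ^ 4
  S≤ : ∀ w → suc w ≤ d → S (suc w) * 2 ^ suc w ≤ R ^ N
  S≤ w w<d = *-cancelʳ-≤ _ _ (R ^ suc w) {{m^n≢0 R (suc w)}} (begin
    S (suc w) * 2 ^ suc w * R ^ suc w
      ≡⟨ swap (S (suc w)) (2 ^ suc w) (R ^ suc w) ⟩
    S (suc w) * R ^ suc w * 2 ^ suc w                        ≡⟨ cong (_* 2 ^ suc w) S-eq ⟩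
    (N C suc w) * R ^ N * paths {n} 𝟘 (suc w * 4) * 2 ^ suc w
      ≡⟨ regroup (N C suc w) (R ^ N) (paths {n} 𝟘 (suc w * 4)) (2 ^ suc w) ⟩
    R ^ N * ((N C suc w) * paths {n} 𝟘 (suc w * 4) * 2 ^ suc w)
      ≤⟨ *-monoʳ-≤ (R ^ N) (dependency-bound n N (suc w) le) ⟩
    R ^ N * R ^ suc w ∎)
    where
    open ≤-Reasoning
    le : 32 * N * suc w ≤ n * n
    le = ≤-trans (*-monoʳ-≤ (32 * N) w<d)
        (≤-trans (≤-reflexive (*-comm (32 * N) d)) (m/n*n≤m (n * n) (32 * N)))
    S-eq : S (suc w) * R ^ suc w ≡ (N C suc w) * R ^ N * paths {n} 𝟘 (suc w * 4)
    S-eq = subst (λ R → S (suc w) * R ^ suc w ≡ (N C suc w) * R ^ N * paths {n} 𝟘 (suc w * 4))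
        (length-rows n) (∑-sets N (suc w) 𝟘)
    swap : ∀ a b c → a * b * c ≡ a * c * b
    swap = solve-∀
    regroup : ∀ c r p t → c * r * p * t ≡ r * (c * p * t)
    regroup = solve-∀
  total = ∑[ f ∈ systems n N ] ∑[ w ∈ upTo d ] sets 𝟘 f (suc w)
  total-small : total < length (rows n) ^ N
  -- Strictness comes from the extra summand `R ^ N`, which is positive, on the left of
  -- `∑-geometric`.
  total-small = *-cancelˡ-< (2 ^ d) _ _ (subst₂ (λ s R → 2 ^ d * s < 2 ^ d * R ^ N)
    (∑-swap (upTo d) (systems n N) _) (sym (length-rows n))
    (<-≤-trans (m<m+n (2 ^ d * ∑ (upTo d) (S ∘ suc)) (m^n>0 (n ^ 4) N))
        (∑-geometric (S ∘ suc) (R ^ N) d S≤)))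
  found = ∑-average-vecs (rows n) N (λ f → ∑[ w ∈ upTo d ] sets 𝟘 f (suc w)) total-small
  f = proj₁ found
  f-good = proj₂ found

-- Linear algebra over 𝔽₂

infixl 6 _⊕_
_⊕_ : Vec Bool n → Vec Bool n → Vec Bool n
_⊕_ = zipWith _xor_

dot : Vec Bool n → Vec Bool n → Bool
dot []      []      = false
dot (a ∷ u) (b ∷ v) = (a ∧ b) xor dot u v

xor-interchange : ∀ a b c d → (a xor b) xor (c xor d) ≡ (a xor c) xor (b xor d)
xor-interchange false b c d =
    trans (sym (xor-assoc b c d)) (trans (cong (_xor d) (xor-comm b c)) (xor-assoc c b d))
xor-interchange true  b c d = trans (sym (not-distribˡ-xor b _))
    (trans (cong not (xor-interchange false b c d)) (not-distribˡ-xor c _))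

dot-⊕ˡ : (u v w : Vec Bool n) → dot (u ⊕ v) w ≡ dot u w xor dot v w
dot-⊕ˡ [] [] [] = refl
dot-⊕ˡ (a ∷ u) (b ∷ v) (c ∷ w) = trans (cong₂ _xor_ (∧-distribʳ-xor c a b) (dot-⊕ˡ u v w))
    (xor-interchange (a ∧ c) (b ∧ c) _ _)

dot-comm : (u v : Vec Bool n) → dot u v ≡ dot v u
dot-comm []      []      = refl
dot-comm (a ∷ u) (b ∷ v) = cong₂ _xor_ (∧-comm a b) (dot-comm u v)

dot-⊕ʳ : (u v w : Vec Bool n) → dot u (v ⊕ w) ≡ dot u v xor dot u w
dot-⊕ʳ u v w = trans (dot-comm u _) (trans (dot-⊕ˡ v w u) (cong₂ _xor_ (dot-comm v u) (dot-comm w u)))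

dot-𝟘ˡ : (v : Vec Bool n) → dot 𝟘 v ≡ false
dot-𝟘ˡ []      = refl
dot-𝟘ˡ (b ∷ v) = dot-𝟘ˡ v

⊕-identityʳ : (u : Vec Bool n) → u ⊕ 𝟘 ≡ u
⊕-identityʳ []      = refl
⊕-identityʳ (a ∷ u) = cong₂ _∷_ (xor-identityʳ a) (⊕-identityʳ u)

⊕-identityˡ : (u : Vec Bool n) → 𝟘 ⊕ u ≡ u
⊕-identityˡ []      = refl
⊕-identityˡ (a ∷ u) = cong (a ∷_) (⊕-identityˡ u)

⊕-cancel : (u v : Vec Bool n) → u ⊕ (v ⊕ u) ≡ v
⊕-cancel []      []      = refl
⊕-cancel (a ∷ u) (b ∷ v) = cong₂ _∷_ (cancel a b) (⊕-cancel u v)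
  where
  cancel : ∀ a b → a xor (b xor a) ≡ b
  cancel false b     = xor-identityʳ b
  cancel true  false = refl
  cancel true  true  = refl

⊕-assoc : (u v w : Vec Bool n) → (u ⊕ v) ⊕ w ≡ u ⊕ (v ⊕ w)
⊕-assoc []      []      []      = refl
⊕-assoc (a ∷ u) (b ∷ v) (c ∷ w) = cong₂ _∷_ (xor-assoc a b c) (⊕-assoc u v w)

toggle-⊕ : (i : Fin n) (u v : Vec Bool n) → toggle i (u ⊕ v) ≡ u ⊕ toggle i v
toggle-⊕ zero    (a ∷ u) (b ∷ v) = cong (_∷ (u ⊕ v)) (not-distribʳ-xor a b)
toggle-⊕ (suc i) (a ∷ u) (b ∷ v) = cong ((a xor b) ∷_) (toggle-⊕ i u v)

toggles-⊕ : (is : Vec (Fin n) r) (u v : Vec Bool n) → toggles is (u ⊕ v) ≡ u ⊕ toggles is v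
toggles-⊕ []       u v = refl
toggles-⊕ (i ∷ is) u v = trans (cong (toggles is) (toggle-⊕ i u v)) (toggles-⊕ is u (toggle i v))

parity : Vec (Fin n) r → Vec Bool n → Bool
parity []       ζ = false
parity (i ∷ is) ζ = lookup ζ i xor parity is ζ

parity-⊕ : (is : Vec (Fin n) r) (ζ ξ : Vec Bool n) → parity is (ζ ⊕ ξ) ≡ parity is ζ xor parity is ξ
parity-⊕ []       ζ ξ = refl
parity-⊕ (i ∷ is) ζ ξ = trans (cong₂ _xor_ (lookup-zipWith _xor_ i ζ ξ) (parity-⊕ is ζ ξ))
  (xor-interchange (lookup ζ i) (lookup ξ i) _ _)

dot-toggle : (i : Fin n) (v ζ : Vec Bool n) → dot (toggle i v) ζ ≡ lookup ζ i xor dot v ζ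
dot-toggle zero (false ∷ v) (b ∷ ζ) = refl
dot-toggle zero (true ∷ v) (false ∷ ζ) = refl
dot-toggle zero (true ∷ v) (true ∷ ζ) = sym (not-involutive _)
dot-toggle (suc i) (a ∷ v) (b ∷ ζ) = trans (cong ((a ∧ b) xor_) (dot-toggle i v ζ))
  (trans (sym (xor-assoc (a ∧ b) (lookup ζ i) _))
      (trans (cong (_xor dot v ζ) (xor-comm (a ∧ b) (lookup ζ i))) (xor-assoc (lookup ζ i) (a ∧ b) _)))

dot-toggles : (is : Vec (Fin n) r) (v ζ : Vec Bool n) → dot (toggles is v) ζ ≡ parity is ζ xor dot v ζ
dot-toggles []       v ζ = refl
dot-toggles (i ∷ is) v ζ = trans (dot-toggles is (toggle i v) ζ)
  (trans (cong (parity is ζ xor_) (dot-toggle i v ζ))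
  (trans (sym (xor-assoc (parity is ζ) (lookup ζ i) _))
      (cong (_xor dot v ζ) (xor-comm (parity is ζ) (lookup ζ i)))))

indicator : Vec (Fin n) r → Vec Bool n
indicator is = toggles is 𝟘

dot-indicator : (is : Vec (Fin n) r) (ζ : Vec Bool n) → dot (indicator is) ζ ≡ parity is ζ
dot-indicator is ζ = trans (dot-toggles is 𝟘 ζ)
    (trans (cong (parity is ζ xor_) (dot-𝟘ˡ ζ)) (xor-identityʳ _))

weight : Vec Bool N → ℕ
weight []      = 0
weight (b ∷ y) = ⟪ b ⟫ + weight y

weight-toggle : (i : Fin N) (y : Vec Bool N) → weight (toggle i y) ≤ suc (weight y)
weight-toggle zero    (false ∷ y) = ≤-refl
weight-toggle zero    (true ∷ y)  = ≤-trans (n≤1+n _) (n≤1+n _)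
weight-toggle (suc i) (b ∷ y)     = ≤-trans (+-monoʳ-≤ ⟪ b ⟫ (weight-toggle i y))
    (≤-reflexive (+-suc ⟪ b ⟫ _))

combine : Vec Bool N → Vec (Vec Bool k) N → Vec Bool k
combine []          []      = 𝟘
combine (true ∷ y)  (v ∷ V) = v ⊕ combine y V
combine (false ∷ y) (v ∷ V) = combine y V

combine-∷ : (y b : Vec Bool N) (V : Vec (Vec Bool k) N) →
    combine y (zipWith _∷_ b V) ≡ dot y b ∷ combine y V
combine-∷ []          []      []      = refl
combine-∷ (true ∷ y)  (c ∷ b) (v ∷ V) = cong ((c ∷ v) ⊕_) (combine-∷ y b V)
combine-∷ (false ∷ y) (c ∷ b) (v ∷ V) = combine-∷ y b V

combine-𝟘 : (V : Vec (Vec Bool k) N) → combine 𝟘 V ≡ 𝟘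
combine-𝟘 []      = refl
combine-𝟘 (v ∷ V) = combine-𝟘 V

⊕-swap : (u v w : Vec Bool k) → u ⊕ (v ⊕ w) ≡ v ⊕ (u ⊕ w)
⊕-swap []      []      []      = refl
⊕-swap (a ∷ u) (b ∷ v) (c ∷ w) = cong₂ _∷_
  (trans (sym (xor-assoc a b c)) (trans (cong (_xor c) (xor-comm a b)) (xor-assoc b a c)))
      (⊕-swap u v w)

combine-toggle : (p : Fin N) (y : Vec Bool N) (V : Vec (Vec Bool k) N) →
  combine (toggle p y) V ≡ lookup V p ⊕ combine y V
combine-toggle zero    (false ∷ y) (v ∷ V) = refl
combine-toggle zero    (true ∷ y)  (v ∷ V) =
    sym (trans (cong (v ⊕_) (⊕-comm v _)) (⊕-cancel v (combine y V)))
  where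
  ⊕-comm : ∀ {k} (u v : Vec Bool k) → u ⊕ v ≡ v ⊕ u
  ⊕-comm []      []      = refl
  ⊕-comm (a ∷ u) (b ∷ v) = cong₂ _∷_ (xor-comm a b) (⊕-comm u v)
combine-toggle (suc p) (false ∷ y) (v ∷ V) = combine-toggle p y V
combine-toggle (suc p) (true ∷ y)  (v ∷ V) = trans (cong (v ⊕_) (combine-toggle p y V))
    (⊕-swap v (lookup V p) _)

nonzero-dot : (v : Vec Bool k) → v ≡ 𝟘 ⊎ ∃ λ δ → dot v δ ≡ true
nonzero-dot []      = inj₁ refl
nonzero-dot (true ∷ v) = inj₂ (true ∷ 𝟘 , cong not (trans (dot-comm v 𝟘) (dot-𝟘ˡ v)))
nonzero-dot (false ∷ v) with nonzero-dot v
... | inj₁ refl      = inj₁ refl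
... | inj₂ (δ , eq) = inj₂ (false ∷ δ , eq)

-- Duality over 𝔽₂, by elimination along `L`. If the functional found for the tail does not kill the
-- new row u, then v + u is tried as well: a combination giving v + u becomes one for v after
-- toggling `p`, and otherwise a second functional is available to correct the first. Each new row
-- toggles at most one coefficient, which bounds the weight by the length of `L`.
span-or-separate : (V : Vec (Vec Bool k) N) (L : List (Fin N)) (v : Vec Bool k) →
  (∃ λ y → weight y ≤ length L × combine y V ≡ v) ⊎
  (∃ λ δ → dot v δ ≡ true × All (λ p → dot (lookup V p) δ ≡ false) L)
span-or-separate {N = N} V [] v with nonzero-dot v
... | inj₁ refl     = inj₁ (𝟘 , ≤-reflexive (weight-𝟘 {N}) , combine-𝟘 V)
  where
  weight-𝟘 : ∀ {N} → weight (𝟘 {N}) ≡ 0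
  weight-𝟘 {zero}  = refl
  weight-𝟘 {suc N} = weight-𝟘 {N}
... | inj₂ (δ , eq) = inj₂ (δ , eq , [])
span-or-separate V (p ∷ L) v with span-or-separate V L v
... | inj₁ (y , le , eq) = inj₁ (y , ≤-trans le (n≤1+n _) , eq)
... | inj₂ (δ , vδ , Lδ) with dot (lookup V p) δ in uδ
...   | false = inj₂ (δ , vδ , uδ ∷ Lδ)
...   | true with span-or-separate V L (v ⊕ lookup V p)
...     | inj₁ (y , le , eq) = inj₁ (toggle p y , ≤-trans (weight-toggle p y) (s≤s le) ,
            trans (combine-toggle p y V) (trans (cong (lookup V p ⊕_) eq) (⊕-cancel (lookup V p) v)))
...     | inj₂ (ε , vuε , Lε) with dot (lookup V p) ε in uε | trans (sym (dot-⊕ˡ v (lookup V p) ε)) vuε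
...       | false | vε = inj₂ (ε , trans (sym (xor-identityʳ _)) vε , uε ∷ Lε)
-- Here ε takes the value 1 on u and 0 on v while δ is 1 on both, so their sum kills u and keeps the
-- value 1 on v.
...       | true  | vε = inj₂ (δ ⊕ ε ,
            trans (dot-⊕ʳ v δ ε) (trans (cong₂ _xor_ vδ (xor-true vε)) refl) ,
            trans (dot-⊕ʳ (lookup V p) δ ε) (cong₂ _xor_ uδ uε) ∷
            All.zipWith (λ {p} (pδ , pε) → trans (dot-⊕ʳ (lookup V p) δ ε) (cong₂ _xor_ pδ pε))
                (Lδ , Lε))
  where
  xor-true : ∀ {a} → a xor true ≡ true → a ≡ false
  xor-true {false} _ = refl

Independent : ℕ → Vec (Vec Bool k) N → Set
Independent q V = ∀ y → 1 ≤ weight y → weight y ≤ q → combine y V ≢ 𝟘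

-- Homogenise: the system is unsolvable iff (1, 0) is spanned by the augmented rows.
solve-system : ∀ {q} (V : Vec (Vec Bool k) N) → Independent q V → (b : Vec Bool N) (L : List (Fin N)) →
  length L ≤ q → ∃ λ ζ → All (λ p → dot (lookup V p) ζ ≡ lookup b p) L
solve-system {k} V ind b L L≤q with span-or-separate (zipWith _∷_ b V) L (true ∷ 𝟘)
-- The leading coordinate forces `dot y b ≡ true`, so `y` is not zero, while its rows sum to zero.
... | inj₁ (y , le , eq) with dot≡true , comb≡𝟘 ← ∷-injective (trans (sym (combine-∷ y b V)) eq) =
  contradiction comb≡𝟘 (ind y (positive y b dot≡true) (≤-trans le L≤q))
  where
  positive : ∀ {N} (y b : Vec Bool N) → dot y b ≡ true → 1 ≤ weight y
  positive []          []      ()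
  positive (true ∷ y)  (c ∷ b) _  = s≤s z≤n
  positive (false ∷ y) (c ∷ b) eq = positive y b eq
-- Pairing to 1 with (1, 0) forces the leading coordinate 1, so vanishing on an augmented row is
-- exactly the equation for `ζ`.
... | inj₂ (true ∷ ζ , _ , Lζ) = ζ , All.map (λ {p} eq → cancel (trans (sym (row p)) eq)) Lζ
  where
  row : ∀ p → dot (lookup (zipWith _∷_ b V) p) (true ∷ ζ) ≡ lookup b p xor dot (lookup V p) ζ
  row p = trans (cong (λ u → dot u (true ∷ ζ)) (lookup-zipWith _∷_ p b V))
      (cong (_xor _) (∧-identityʳ (lookup b p)))
  cancel : ∀ {a c} → a xor c ≡ false → c ≡ a
  cancel {false} eq = eq
  cancel {true}  {true} _ = refl
... | inj₂ (false ∷ ζ , eq , _) with () ← trans (sym (dot-𝟘ˡ ζ)) eq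

-- `y` selects one branch of the recursion of `sets`: take the row at `true`, skip it at `false`.
-- Hence a zero count rules out every dependent `y` of that weight.
sets-combine : (v : Vec Bool n) (f : Vec (Row n) N) (y : Vec Bool N) →
  ⟪ isZero (v ⊕ combine y (Vec.map indicator f)) ⟫ ≤ sets v f (weight y)
sets-combine v []      []          = ≤-reflexive (cong (⟪_⟫ ∘ isZero) (⊕-identityʳ v))
sets-combine v (r ∷ f) (false ∷ y) = ≤-trans (sets-combine v f y) (skip (weight y))
  where
  skip : ∀ w → sets v f w ≤ sets v (r ∷ f) w
  skip zero    = ≤-refl
  skip (suc w) = m≤m+n _ _
sets-combine v (r ∷ f) (true ∷ y)  =
  ≤-trans (≤-reflexive (cong (⟪_⟫ ∘ isZero) absorb))
      (≤-trans (sets-combine (toggles r v) f y) (m≤n+m _ _))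
  where
  absorb : v ⊕ (indicator r ⊕ combine y (Vec.map indicator f)) ≡
      toggles r v ⊕ combine y (Vec.map indicator f)
  absorb = trans (sym (⊕-assoc v _ _)) (cong (_⊕ combine y (Vec.map indicator f))
    (trans (sym (toggles-⊕ r v 𝟘)) (cong (toggles r) (⊕-identityʳ v))))

independent-indicators : (f : Vec (Row n) N) → (∀ w → 32 * N * suc w ≤ n * n → sets 𝟘 f (suc w) ≡ 0) →
  ∀ q → 32 * N * q ≤ n * n → Independent q (Vec.map indicator f)
independent-indicators {n} {N} f none q le y 1≤w w≤q eq with weight y in wy
... | suc w = contradiction (≤-trans (≤-reflexive (sym (isZero-𝟘 {n}))) (≤-trans
        (≤-reflexive (cong (⟪_⟫ ∘ isZero) (sym (trans (⊕-identityˡ _) eq))))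
        (≤-trans (sets-combine 𝟘 f y) (≤-reflexive (trans (cong (sets 𝟘 f) wy)
          (none w (≤-trans (*-monoʳ-≤ (32 * N) w≤q) le))))))) λ ()
  where
  isZero-𝟘 : ∀ {n} → ⟪ isZero (𝟘 {n}) ⟫ ≡ 1
  isZero-𝟘 {zero}  = refl
  isZero-𝟘 {suc n} = isZero-𝟘 {n}

-- Hamming distance

xorB≡xor : ∀ a b → xorB a b ≡ a xor b
xorB≡xor false b     = refl
xorB≡xor true  false = refl
xorB≡xor true  true  = refl

hamming-∑ : (x y : Word N) → hamming x y ≡ ∑[ p ∈ allFin N ] ⟪ lookup x p xor lookup y p ⟫
hamming-∑ []      []      = refl
hamming-∑ {suc N} (a ∷ x) (b ∷ y) = trans (cong₂ (λ c s → ⟪ c ⟫ + s) (xorB≡xor a b) (hamming-∑ x y))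
  (sym (∑-allFin {N} _))

words : (n : ℕ) → List (Word n)
words = vecs (false ∷ true ∷ [])

length-words : ∀ n → length (words n) ≡ 2 ^ n
length-words = length-vecs (false ∷ true ∷ [])

≤-∑-words : (g : Word n → ℕ) (ζ : Word n) → g ζ ≤ ∑ (words n) g
≤-∑-words {zero}  g []      = m≤m+n (g []) 0
≤-∑-words {suc n} g (b ∷ ζ) = ≤-trans (≤-∑-words (g ∘ (b ∷_)) ζ)
  (≤-trans (half b) (≤-reflexive (sym (∑-vecs _ n g))))
  where
  half : ∀ b → ∑ (words n) (g ∘ (b ∷_)) ≤
      ∑ (words n) (g ∘ (false ∷_)) + (∑ (words n) (g ∘ (true ∷_)) + 0)
  half false = m≤m+n (∑ (words n) (g ∘ (false ∷_))) _
  half true  = ≤-trans (≤-reflexive (sym (+-identityʳ _))) (m≤n+m _ (∑ (words n) (g ∘ (false ∷_))))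

-- Translation permutes the words. This invariance of the uniform distribution is what hides the
-- translate from a shallow decision tree.
∑-words-shift : (g : Word n → ℕ) (δ : Word n) → ∑[ ζ ∈ words n ] g (ζ ⊕ δ) ≡ ∑ (words n) g
∑-words-shift {zero}  g []      = refl
∑-words-shift {suc n} g (d ∷ δ) = trans (∑-vecs _ n _) (trans (halves d) (sym (∑-vecs _ n g)))
  where
  h : Bool → ℕ
  h b = ∑ (words n) (g ∘ (b ∷_))
  shifted : ∀ b → (∑[ ζ ∈ words n ] g (b ∷ (ζ ⊕ δ))) ≡ h b
  shifted b = ∑-words-shift (g ∘ (b ∷_)) δ
  swap : ∀ a b → a + (b + 0) ≡ b + (a + 0)
  swap = solve-∀
  halves : ∀ d → ∑[ b ∈ false ∷ true ∷ [] ] ∑[ ζ ∈ words n ] g ((b xor d) ∷ (ζ ⊕ δ)) ≡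
      ∑ (false ∷ true ∷ []) h
  halves false = ∑-cong (false ∷ true ∷ []) λ b →
      trans (cong (λ c → ∑[ ζ ∈ words n ] g (c ∷ (ζ ⊕ δ))) (xor-identityʳ b)) (shifted b)
  halves true  = trans (cong₂ (λ s t → s + (t + 0)) (shifted true) (shifted false))
      (swap (h true) (h false))

-- 3 ^ (number of agreements): its mean over all words is 2 ^ N, and this exponential moment
-- replaces a bound on the volume of Hamming balls in far-word.
agreement : Word N → Word N → ℕ
agreement []      []      = 1
agreement (a ∷ w) (b ∷ z) = (if a xor b then 1 else 3) * agreement w z

agreement-hamming : (w z : Word N) → agreement w z * 3 ^ hamming w z ≡ 3 ^ N
agreement-hamming []      []      = refl
agreement-hamming (a ∷ w) (b ∷ z) rewrite xorB≡xor a b with a xor b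
... | true  = trans (regroup (agreement w z) _) (cong (3 *_) (agreement-hamming w z))
  where
  regroup : ∀ g t → 1 * g * (3 * t) ≡ 3 * (g * t)
  regroup = solve-∀
... | false = trans (*-assoc 3 (agreement w z) _) (cong (3 *_) (agreement-hamming w z))

∑-agreement : (z : Word N) → ∑[ w ∈ words N ] agreement w z ≡ 4 ^ N
∑-agreement []      = refl
∑-agreement {suc N} (b ∷ z) = trans (∑-vecs _ N _) (trans (halves b) (cong (4 *_) (∑-agreement z)))
  where
  S = ∑[ w ∈ words N ] agreement w z
  sum-13 : ∀ s → 1 * s + (3 * s + 0) ≡ 4 * s
  sum-13 = solve-∀
  sum-31 : ∀ s → 3 * s + (1 * s + 0) ≡ 4 * s
  sum-31 = solve-∀
  halves : ∀ b → ∑[ a ∈ false ∷ true ∷ [] ] ∑[ w ∈ words N ] agreement (a ∷ w) (b ∷ z) ≡ 4 * S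
  halves false = trans (cong₂ (λ s t → s + (t + 0)) (∑-*ˡ 3 (words N) _) (∑-*ˡ 1 (words N) _))
      (sum-31 S)
  halves true  = trans (cong₂ (λ s t → s + (t + 0)) (∑-*ˡ 1 (words N) _) (∑-*ˡ 3 (words N) _))
      (sum-13 S)

-- A codeword within distance e of w has agreement at least 3^(N-e) with it, whereas the agreement
-- summed over all 2^n codewords averages 2^n · 4^N / 2^N = 2^(n+N) over w.
far-word : ∀ {n N} e → 4 * e ≤ N → 8 * n < N → (code : Word n → Word N) →
  ∃ λ w → ∀ ζ → e < hamming w (code ζ)
far-word {n} {N} e 4e≤N 8n<N code = w , λ ζ → ≰⇒> λ h≤e →
    <⇒≱ small (≤-trans (large ζ h≤e) (≤-∑-words _ ζ))
  where
  open ≤-Reasoning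
  m = 3 ^ (N ∸ e)
  e≤N : e ≤ N
  e≤N = ≤-trans (m≤n*m e 4) 4e≤N
  -- Eighth powers clear the fractions in n < N/8 and e ≤ N/4; what remains is 2^(9N) = 8^(3N) ≤
  -- 9^(3N) = 3^(6N).
  2<3 : 2 ^ (n + N) < m
  2<3 = ≰⇒> λ m≤2 → <⇒≱ (begin-strict
    (2 ^ (n + N)) ^ 8    ≡⟨ ^-*-assoc 2 (n + N) 8 ⟩
    2 ^ ((n + N) * 8)
      <⟨ ^-monoʳ-< 2 (s≤s (s≤s z≤n))
          (≤-<-trans (≤-reflexive (expand n N)) (<-≤-trans (+-monoˡ-< (8 * N) 8n<N) ≤-refl)) ⟩
    2 ^ (N + 8 * N)      ≡⟨ cong (2 ^_) (nine N) ⟩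
    2 ^ (3 * (3 * N))    ≡⟨ sym (^-*-assoc 2 3 (3 * N)) ⟩
    8 ^ (3 * N)          ≤⟨ ^-monoˡ-≤ (3 * N) (n≤1+n 8) ⟩
    9 ^ (3 * N)          ≡⟨ ^-*-assoc 3 2 (3 * N) ⟩
    3 ^ (2 * (3 * N))    ≤⟨ ^-monoʳ-≤ 3 six ⟩
    3 ^ ((N ∸ e) * 8)    ≡⟨ sym (^-*-assoc 3 (N ∸ e) 8) ⟩
    m ^ 8 ∎) (^-monoˡ-≤ 8 m≤2)
    where
    expand : ∀ n N → (n + N) * 8 ≡ 8 * n + 8 * N
    expand = solve-∀
    nine : ∀ N → N + 8 * N ≡ 3 * (3 * N)
    nine = solve-∀
    six : 2 * (3 * N) ≤ (N ∸ e) * 8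
    six = +-cancelʳ-≤ (2 * (4 * e)) _ _ (begin
      2 * (3 * N) + 2 * (4 * e)   ≤⟨ +-monoʳ-≤ (2 * (3 * N)) (*-monoʳ-≤ 2 4e≤N) ⟩
      2 * (3 * N) + 2 * N         ≡⟨ eight N ⟩
      N * 8                       ≡⟨ cong (_* 8) (sym (m∸n+n≡m e≤N)) ⟩
      (N ∸ e + e) * 8             ≡⟨ spread (N ∸ e) e ⟩
      (N ∸ e) * 8 + 2 * (4 * e) ∎)
      where
      eight : ∀ N → 2 * (3 * N) + 2 * N ≡ N * 8
      eight = solve-∀
      spread : ∀ a e → (a + e) * 8 ≡ a * 8 + 2 * (4 * e)
      spread = solve-∀
  average : ∑[ w ∈ words N ] ∑[ ζ ∈ words n ] agreement w (code ζ) < length (words N) * m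
  average = begin-strict
    (∑[ w ∈ words N ] ∑[ ζ ∈ words n ] agreement w (code ζ)) ≡⟨ ∑-swap (words N) (words n) _ ⟩
    (∑[ ζ ∈ words n ] ∑[ w ∈ words N ] agreement w (code ζ))
      ≡⟨ ∑-cong (words n) (λ ζ → ∑-agreement (code ζ)) ⟩
    (∑[ ζ ∈ words n ] 4 ^ N)                                 ≡⟨ ∑-const (4 ^ N) (words n) ⟩
    length (words n) * 4 ^ N
      ≡⟨ cong₂ _*_ (length-words n) (^-distribʳ-* N 2 2) ⟩
    2 ^ n * (2 ^ N * 2 ^ N)                                  ≡⟨ regroup (2 ^ n) (2 ^ N) ⟩
    2 ^ N * (2 ^ n * 2 ^ N)
      ≡⟨ cong (2 ^ N *_) (sym (^-distribˡ-+-* 2 n N)) ⟩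
    2 ^ N * 2 ^ (n + N)
      <⟨ *-monoʳ-< (2 ^ N) {{m^n≢0 2 N}} 2<3 ⟩
    2 ^ N * m                                                ≡⟨ cong (_* m) (sym (length-words N)) ⟩
    length (words N) * m ∎
    where
    regroup : ∀ a b → a * (b * b) ≡ b * (a * b)
    regroup = solve-∀
    ^-distribʳ-* : ∀ N a b → (a * b) ^ N ≡ a ^ N * b ^ N
    ^-distribʳ-* zero    a b = refl
    ^-distribʳ-* (suc N) a b = trans (cong (a * b *_) (^-distribʳ-* N a b))
        (reorder a b (a ^ N) (b ^ N))
      where
      reorder : ∀ a b c d → a * b * (c * d) ≡ a * c * (b * d)
      reorder = solve-∀
  found = ∑-average (words N) (λ w → ∑[ ζ ∈ words n ] agreement w (code ζ)) average
  w = proj₁ found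
  small = proj₂ found
  large : ∀ ζ → hamming w (code ζ) ≤ e → m ≤ agreement w (code ζ)
  large ζ h≤e = *-cancelʳ-≤ m _ (3 ^ e) {{m^n≢0 3 e}} (begin
    3 ^ (N ∸ e) * 3 ^ e                         ≡⟨ sym (^-distribˡ-+-* 3 (N ∸ e) e) ⟩
    3 ^ (N ∸ e + e)                             ≡⟨ cong (3 ^_) (m∸n+n≡m e≤N) ⟩
    3 ^ N                                       ≡⟨ sym (agreement-hamming w (code ζ)) ⟩
    agreement w (code ζ) * 3 ^ hamming w (code ζ)
      ≤⟨ *-monoʳ-≤ (agreement w (code ζ)) (^-monoʳ-≤ 3 h≤e) ⟩
    agreement w (code ζ) * 3 ^ e ∎)

∑-below : ∀ N n → ∑[ p ∈ allFin N ] ⟪ toℕ p <ᵇ n ⟫ ≤ n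
∑-below N       zero    = ≤-reflexive (∑-zero (allFin N) λ p → cong ⟪_⟫ (below-0 (toℕ p)))
  where
  below-0 : ∀ m → (m <ᵇ 0) ≡ false
  below-0 zero = refl
  below-0 (suc m) = refl
∑-below zero    (suc n) = z≤n
∑-below (suc N) (suc n) = ≤-trans (≤-reflexive (∑-allFin {N} λ p → ⟪ toℕ p <ᵇ suc n ⟫))
    (s≤s (∑-below N n))

-- Query algorithms

length-accept : (ts : List (DTree N)) (x : Word N) →
  length (filter (λ t → run t x Bool.≟ true) ts) ≡ ∑[ t ∈ ts ] ⟪ run t x ⟫
length-accept []       x = refl
length-accept (t ∷ ts) x with run t x
... | true  = cong suc (length-accept ts x)
... | false = length-accept ts x

length-reject : (ts : List (DTree N)) (x : Word N) →
  length (filter (λ t → run t x Bool.≟ false) ts) ≡ ∑[ t ∈ ts ] ⟪ not (run t x) ⟫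
length-reject []       x = refl
length-reject (t ∷ ts) x with run t x
... | true  = length-reject ts x
... | false = cong suc (length-reject ts x)

∑-not : (xs : List A) (g : A → Bool) → (∑[ x ∈ xs ] ⟪ g x ⟫) + (∑[ x ∈ xs ] ⟪ not (g x) ⟫) ≡ length xs
∑-not xs g = trans (sym (∑-+ xs _ _))
    (trans (∑-cong xs λ x → one (g x)) (trans (∑-const 1 xs) (*-identityʳ _)))
  where
  one : ∀ b → ⟪ b ⟫ + ⟪ not b ⟫ ≡ 1
  one true  = refl
  one false = refl

accept+reject : (A : RandAlg N) (x : Word N) → #accept A x + #reject A x ≡ length (toList A)
accept+reject A x = trans (cong₂ _+_ (length-accept (toList A) x) (length-reject (toList A) x))
    (∑-not (toList A) λ t → run t x)

depth≤queries : (ts : List (DTree N)) → All (λ t → depth t ≤ List.foldr (λ t m → depth t ⊔ m) 0 ts) ts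
depth≤queries []       = []
depth≤queries (t ∷ ts) = m≤m⊔n (depth t) _ ∷ All.map (λ le → ≤-trans le (m≤n⊔m (depth t) _))
    (depth≤queries ts)

queries≤ : ∀ {q} (ts : List (DTree N)) → All (λ t → depth t ≤ q) ts →
    List.foldr (λ t m → depth t ⊔ m) 0 ts ≤ q
queries≤ []       []         = z≤n
queries≤ (t ∷ ts) (le ∷ les) = ⊔-lub le (queries≤ ts les)

xorAt : List (Fin N) → Word N → Bool
xorAt []       x = false
xorAt (p ∷ ps) x = lookup x p xor xorAt ps x

-- The running parity is kept in the continuation: an answer of one negates its argument.
readXor : List (Fin N) → (Bool → DTree N) → DTree N
readXor []       k = k false
readXor (p ∷ ps) k = query p (readXor ps k) (readXor ps (k ∘ not))

run-readXor : (ps : List (Fin N)) (k : Bool → DTree N) (x : Word N) →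
    run (readXor ps k) x ≡ run (k (xorAt ps x)) x
run-readXor []       k x = refl
run-readXor (p ∷ ps) k x with lookup x p
... | true  = run-readXor ps (k ∘ not) x
... | false = run-readXor ps k x

depth-readXor : ∀ {d} (ps : List (Fin N)) (k : Bool → DTree N) → (∀ b → depth (k b) ≤ d) →
    depth (readXor ps k) ≤ length ps + d
depth-readXor []       k le = le false
depth-readXor (p ∷ ps) k le =
    s≤s (⊔-lub (depth-readXor ps k le) (depth-readXor ps (k ∘ not) (le ∘ not)))

bernoulli : ∀ u v s → u ^ suc s + suc s * (v * u ^ s) ≤ (u + v) ^ suc s
bernoulli u v zero    = ≤-reflexive (simp u v)
  where
  simp : ∀ u v → u * 1 + 1 * (v * 1) ≡ (u + v) * 1
  simp = solve-∀
bernoulli u v (suc s) = begin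
  u * (u * u ^ s) + suc (suc s) * (v * (u * u ^ s))   ≤⟨ m≤m+n _ (v * (suc s * (v * u ^ s))) ⟩
  u * (u * u ^ s) + suc (suc s) * (v * (u * u ^ s)) + v * (suc s * (v * u ^ s))
    ≡⟨ regroup u v (suc s) (u ^ s) ⟩
  (u + v) * (u * u ^ s + suc s * (v * u ^ s))     ≤⟨ *-monoʳ-≤ (u + v) (bernoulli u v s) ⟩
  (u + v) * (u + v) ^ suc s ∎
  where
  open ≤-Reasoning
  regroup : ∀ u v s q → u * (u * q) + (1 + s) * (v * (u * q)) + v * (s * (v * q)) ≡
      (u + v) * (u * q + s * (v * q))
  regroup = solve-∀

-- In the expansion of (u + v)^(2c+1) the term linear in v is at least 2c · v · u^(2c), hence at
-- least twice the leading power of u. So 2c+1 trials bring acceptance down to 1/3.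
amplification : ∀ u v c → u ≤ c * v → 3 * u ^ suc (2 * c) ≤ (u + v) ^ suc (2 * c)
amplification u v c u≤cv = begin
  3 * (u * u ^ s)                        ≡⟨ split u (u ^ s) ⟩
  u * u ^ s + 2 * u * u ^ s
    ≤⟨ +-monoʳ-≤ (u * u ^ s) (*-monoˡ-≤ (u ^ s) (*-monoʳ-≤ 2 u≤cv)) ⟩
  u * u ^ s + 2 * (c * v) * u ^ s        ≡⟨ cong (u * u ^ s +_) (regroup c v (u ^ s)) ⟩
  u * u ^ s + s * (v * u ^ s)
    ≤⟨ +-monoʳ-≤ (u * u ^ s) (*-monoˡ-≤ (v * u ^ s) (n≤1+n s)) ⟩
  u * u ^ s + suc s * (v * u ^ s)        ≤⟨ bernoulli u v s ⟩
  (u + v) ^ suc s ∎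
  where
  open ≤-Reasoning
  s = 2 * c
  split : ∀ u q → 3 * (u * q) ≡ u * q + 2 * u * q
  split = solve-∀
  regroup : ∀ c v q → 2 * (c * v) * q ≡ 2 * c * (v * q)
  regroup = solve-∀

nonempty-list : (ts : List A) → 0 < length ts → ∃ λ (ts⁺ : List⁺ A) → toList ts⁺ ≡ ts
nonempty-list (t ∷ ts) _ = (t ∷ ts) , refl

-- The code defined by a system of rows

module Code {n N : ℕ} (n≤N : n ≤ N) (f : Vec (Row n) N) where

  free : Fin N → Bool
  free p = toℕ p <ᵇ n

  position : Fin n → Fin N
  position i = inject≤ i n≤N

  free-position : ∀ i → free (position i) ≡ true
  free-position i = Equivalence.to T-≡
      (<⇒<ᵇ (≤-trans (≤-reflexive (cong suc (toℕ-inject≤ i n≤N))) (toℕ<n i)))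

  #free : ∑[ p ∈ allFin N ] ⟪ free p ⟫ ≤ n
  #free = ∑-below N n

  -- A free position gets the empty check, which always holds, so trials can draw uniformly from all
  -- N positions.
  checks : Fin N → List (Fin N)
  checks p = if free p then [] else p ∷ Vec.toList (Vec.map position (lookup f p))

  violated : Word N → Fin N → Bool
  violated x p = xorAt (checks p) x

  violations : Word N → ℕ
  violations x = ∑[ p ∈ allFin N ] ⟪ violated x p ⟫

  isMember : Word N → Bool
  isMember x = violations x ≡ᵇ 0

  restrict : Word N → Word n
  restrict x = tabulate (lookup x ∘ position)

  xorAt-positions : ∀ {r} (is : Vec (Fin n) r) x →
      xorAt (Vec.toList (Vec.map position is)) x ≡ parity is (restrict x)
  xorAt-positions []       x = refl
  xorAt-positions (i ∷ is) x = cong₂ _xor_ (sym (lookup∘tabulate (lookup x ∘ position) i))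
      (xorAt-positions is x)

  encode : Word n → Word N
  encode ζ = tabulate λ p → if free p then false else parity (lookup f p) ζ

  lookup-encode : ∀ ζ p → lookup (encode ζ) p ≡ (if free p then false else parity (lookup f p) ζ)
  lookup-encode ζ = lookup∘tabulate _

  violated≡ : ∀ x p → violated x p ≡
      (if free p then false else lookup x p xor lookup (encode (restrict x)) p)
  violated≡ x p rewrite lookup-encode (restrict x) p with free p
  ... | true  = refl
  ... | false = cong (lookup x p xor_) (xorAt-positions (lookup f p) x)

  repair : Word N → Word N
  repair x = tabulate λ p → if free p then lookup x p else lookup (encode (restrict x)) p

  lookup-repair : ∀ x p → lookup (repair x) p ≡
      (if free p then lookup x p else lookup (encode (restrict x)) p)
  lookup-repair x = lookup∘tabulate _

  restrict-repair : ∀ x → restrict (repair x) ≡ restrict x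
  restrict-repair x = tabulate-cong λ i →
    trans (lookup-repair x (position i))
        (cong (λ b → if b then lookup x (position i) else lookup (encode (restrict x)) (position i))
            (free-position i))

  repair-member : ∀ x → isMember (repair x) ≡ true
  repair-member x = Equivalence.to T-≡ (≡⇒≡ᵇ _ 0 (∑-zero (allFin N) λ p → cong ⟪_⟫ (satisfied p)))
    where
    satisfied : ∀ p → violated (repair x) p ≡ false
    satisfied p = trans (violated≡ (repair x) p) (by-cases (free p) refl)
      where
      by-cases : ∀ b → free p ≡ b →
          (if b then false else lookup (repair x) p xor lookup (encode (restrict (repair x))) p) ≡ false
      by-cases true  _  = refl
      by-cases false eq = trans
          (cong₂ _xor_ (trans (lookup-repair x p)
              (cong (λ b → if b then lookup x p else lookup (encode (restrict x)) p) eq))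
        (cong (λ ζ → lookup (encode ζ) p) (restrict-repair x)))
            (xor-same (lookup (encode (restrict x)) p))

  hamming-repair : ∀ x → hamming x (repair x) ≤ violations x
  hamming-repair x = ≤-trans (≤-reflexive (hamming-∑ x (repair x))) (∑-mono (allFin N) pointwise)
    where
    pointwise : ∀ p → ⟪ lookup x p xor lookup (repair x) p ⟫ ≤ ⟪ violated x p ⟫
    pointwise p rewrite lookup-repair x p | violated≡ x p with free p
    ... | true  = ≤-reflexive (cong ⟪_⟫ (xor-same (lookup x p)))
    ... | false = ≤-refl

  member⇒violations≡0 : ∀ x → isMember x ≡ true → violations x ≡ 0
  member⇒violations≡0 x eq = ≡ᵇ⇒≡ _ 0 (Equivalence.from T-≡ eq)

  -- The constant-query tester

  length-checks : ∀ p → length (checks p) ≤ 5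
  length-checks p with free p
  ... | true  = z≤n
  ... | false = ≤-reflexive (cong suc (length-toList (Vec.map position (lookup f p))))

  trial : Fin N → DTree N → DTree N
  trial p t = readXor (checks p) λ b → if b then leaf false else t

  -- One tree per sequence of s positions: a uniform choice from this list performs s independent
  -- trials, so acceptance counts are powers.
  trials : ℕ → List (DTree N)
  trials zero    = leaf true ∷ []
  trials (suc s) = cartesianProductWith trial (allFin N) (trials s)

  depth-trials : ∀ s → All (λ t → depth t ≤ s * 5) (trials s)
  depth-trials zero    = z≤n ∷ []
  depth-trials (suc s) = over (allFin N)
    where
    depth-trial : ∀ p {t} → depth t ≤ s * 5 → depth (trial p t) ≤ suc s * 5
    depth-trial p le = ≤-trans (depth-readXor (checks p) _ (λ { true → z≤n ; false → le }))
        (+-monoˡ-≤ (s * 5) (length-checks p))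
    over : ∀ ps → All (λ t → depth t ≤ suc s * 5) (cartesianProductWith trial ps (trials s))
    over []       = []
    over (p ∷ ps) = All.++⁺ (All.map⁺ (All.map (depth-trial p) (depth-trials s))) (over ps)

  length-trials : ∀ s → length (trials s) ≡ N ^ s
  length-trials zero    = refl
  length-trials (suc s) = trans (length-cartesianProductWith trial (allFin N) (trials s))
    (cong₂ _*_ (length-tabulate {n = N} id) (length-trials s))

  satisfactions : Word N → ℕ
  satisfactions x = ∑[ p ∈ allFin N ] ⟪ not (violated x p) ⟫

  violations+satisfactions : ∀ x → violations x + satisfactions x ≡ N
  violations+satisfactions x = trans (∑-not (allFin N) (violated x)) (length-tabulate {n = N} id)

  ∑-trials : ∀ s x → ∑[ t ∈ trials s ] ⟪ run t x ⟫ ≡ satisfactions x ^ s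
  ∑-trials zero    x = refl
  ∑-trials (suc s) x = begin
    (∑[ t ∈ trials (suc s) ] ⟪ run t x ⟫)
      ≡⟨ ∑-cartesianProductWith trial (allFin N) (trials s) _ ⟩
    (∑[ p ∈ allFin N ] ∑[ t ∈ trials s ] ⟪ run (trial p t) x ⟫)
      ≡⟨ ∑-cong (allFin N) (λ p → ∑-cong (trials s) (run-trial p)) ⟩
    (∑[ p ∈ allFin N ] ∑[ t ∈ trials s ] ⟪ not (violated x p) ⟫ * ⟪ run t x ⟫)
      ≡⟨ ∑-cong (allFin N) (λ p → ∑-*ˡ ⟪ not (violated x p) ⟫ (trials s) _) ⟩
    (∑[ p ∈ allFin N ] ⟪ not (violated x p) ⟫ * (∑[ t ∈ trials s ] ⟪ run t x ⟫))
      ≡⟨ ∑-*ʳ _ (allFin N) _ ⟩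
    satisfactions x * (∑[ t ∈ trials s ] ⟪ run t x ⟫)
      ≡⟨ cong (satisfactions x *_) (∑-trials s x) ⟩
    satisfactions x * satisfactions x ^ s ∎
    where
    open ≡-Reasoning
    run-trial : ∀ p t → ⟪ run (trial p t) x ⟫ ≡ ⟪ not (violated x p) ⟫ * ⟪ run t x ⟫
    run-trial p t rewrite run-readXor (checks p) (λ b → if b then leaf false else t) x with xorAt
        (checks p) x
    ... | true  = refl
    ... | false = sym (+-identityʳ _)

  -- For the rejection part, distance at least N/(c+1) passes through `repair` to at least N/(c+1)
  -- violations, hence at most c satisfied positions per violated one, as `amplification` requires.
  property-tester : ∀ c .{{_ : NonZero N}} → let s = suc (2 * c) in
    ∃ λ (A : RandAlg N) → (queries A ≤ s * 5) ×
      (∀ x → isMember x ≡ true → AcceptsWHP A x) ×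
      (∀ x → (∀ y → isMember y ≡ true → N ≤ suc c * hamming x y) → RejectsWHP A x)
  property-tester c with nonempty-list (trials (suc (2 * c)))
      (subst (0 <_) (sym (length-trials (suc (2 * c)))) (m^n>0 N (suc (2 * c))))
  ... | A , eq = A , subst (λ ts → List.foldr (λ t m → depth t ⊔ m) 0 ts ≤ s * 5) (sym eq)
      (queries≤ (trials s) (depth-trials s)) , accepts , rejects
    where
    open ≤-Reasoning
    s = suc (2 * c)
    #A : length (toList A) ≡ N ^ s
    #A = trans (cong length eq) (length-trials s)
    #acc : ∀ x → #accept A x ≡ satisfactions x ^ s
    #acc x = trans (length-accept (toList A) x)
        (trans (cong (λ ts → ∑[ t ∈ ts ] ⟪ run t x ⟫) eq) (∑-trials s x))
    accepts : ∀ x → isMember x ≡ true → AcceptsWHP A x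
    accepts x x∈ = begin
      2 * length (toList A)   ≤⟨ *-monoˡ-≤ (length (toList A)) (n≤1+n 2) ⟩
      3 * length (toList A)   ≡⟨ cong (3 *_) (trans #A (cong (_^ s) (sym N≡))) ⟩
      3 * satisfactions x ^ s ≡⟨ cong (3 *_) (sym (#acc x)) ⟩
      3 * #accept A x ∎
      where
      N≡ : satisfactions x ≡ N
      N≡ = trans (cong (_+ satisfactions x) (sym (member⇒violations≡0 x x∈)))
          (violations+satisfactions x)
    rejects : ∀ x → (∀ y → isMember y ≡ true → N ≤ suc c * hamming x y) → RejectsWHP A x
    rejects x far = +-cancelˡ-≤ (3 * #accept A x) _ _ (begin
      3 * #accept A x + 2 * length (toList A)       ≤⟨ +-monoˡ-≤ _ few ⟩
      length (toList A) + 2 * length (toList A)     ≡⟨⟩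
      3 * length (toList A)                         ≡⟨ cong (3 *_) (sym (accept+reject A x)) ⟩
      3 * (#accept A x + #reject A x)               ≡⟨ *-distribˡ-+ 3 (#accept A x) (#reject A x) ⟩
      3 * #accept A x + 3 * #reject A x ∎)
      where
      u = satisfactions x
      v = violations x
      u≤cv : u ≤ c * v
      u≤cv = +-cancelˡ-≤ v _ _ (begin
        v + u                          ≡⟨ violations+satisfactions x ⟩
        N                              ≤⟨ far (repair x) (repair-member x) ⟩
        suc c * hamming x (repair x)   ≤⟨ *-monoʳ-≤ (suc c) (hamming-repair x) ⟩
        v + c * v ∎)
      few : 3 * #accept A x ≤ length (toList A)
      few = begin
        3 * #accept A x ≡⟨ cong (3 *_) (#acc x) ⟩
        3 * u ^ s       ≤⟨ amplification u v c u≤cv ⟩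
        (u + v) ^ s     ≡⟨ cong (_^ s) (trans (+-comm u v) (violations+satisfactions x)) ⟩
        N ^ s           ≡⟨ sym #A ⟩
        length (toList A) ∎

  -- Hardness of tolerant testing

  padAt : Word n → Fin N → Bool
  padAt ζ p with toℕ p <? n
  ... | yes p<n = lookup ζ (fromℕ< p<n)
  ... | no  _   = false

  pad : Word n → Word N
  pad ζ = tabulate (padAt ζ)

  restrict-pad : ∀ ζ → restrict (pad ζ) ≡ ζ
  restrict-pad ζ = trans (tabulate-cong λ i →
      trans (lookup∘tabulate (padAt ζ) (position i)) (padAt-position i)) (tabulate∘lookup ζ)
    where
    padAt-position : ∀ i → padAt ζ (position i) ≡ lookup ζ i
    padAt-position i with toℕ (position i) <? n
    ... | yes p<n = cong (lookup ζ) (toℕ-injective (trans (toℕ-fromℕ< p<n) (toℕ-inject≤ i n≤N)))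
    ... | no  p≮n = contradiction (≤-trans (≤-reflexive (cong suc (toℕ-inject≤ i n≤N))) (toℕ<n i)) p≮n

  encode-⊕ : ∀ ζ ξ p → lookup (encode (ζ ⊕ ξ)) p ≡ lookup (encode ζ) p xor lookup (encode ξ) p
  encode-⊕ ζ ξ p rewrite lookup-encode (ζ ⊕ ξ) p | lookup-encode ζ p | lookup-encode ξ p with free p
  ... | true  = refl
  ... | false = parity-⊕ (lookup f p) ζ ξ

  -- The list is the transcript of positions queried and answers received; it splits a sum over ζ by
  -- computation path.
  consistent : List (Fin N × Bool) → Word N → Bool
  consistent []            x = true
  consistent ((p , a) ∷ L) x = not (a xor lookup x p) ∧ consistent L x

  consistent-cong : ∀ L {x y} → All (λ p → lookup x p ≡ lookup y p) (map proj₁ L) →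
      consistent L x ≡ consistent L y
  consistent-cong []            []         = refl
  consistent-cong ((p , a) ∷ L) (eq ∷ eqs) = cong₂ (λ b c → not (a xor b) ∧ c) eq
      (consistent-cong L eqs)

  split-query : ∀ L p t₀ t₁ x → ⟪ consistent L x ∧ run (query p t₀ t₁) x ⟫ ≡
    ⟪ consistent ((p , false) ∷ L) x ∧ run t₀ x ⟫ + ⟪ consistent ((p , true) ∷ L) x ∧ run t₁ x ⟫
  split-query L p t₀ t₁ x with lookup x p
  ... | true  = refl
  ... | false = sym (+-identityʳ _)

  -- Shifting ζ by a solution of "encode ζ* = b on the queried positions" turns the
  -- computation path on encode ζ into the same path on b + encode ζ.
  indistinguishable : ∀ q → Independent q (Vec.map indicator f) → ∀ b →
      (∀ p → free p ≡ true → lookup b p ≡ false) →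
    ∀ t L → length L + depth t ≤ q →
    ∑[ ζ ∈ words n ] ⟪ consistent L (encode ζ) ∧ run t (encode ζ) ⟫ ≡
    ∑[ ζ ∈ words n ] ⟪ consistent L (b ⊕ encode ζ) ∧ run t (b ⊕ encode ζ) ⟫
  indistinguishable q ind b b-free (leaf a) L le
    with ξ , sol ← solve-system (Vec.map indicator f) ind b (map proj₁ L)
           (≤-trans (≤-reflexive (trans (length-map proj₁ L) (sym (+-identityʳ _)))) le) =
    trans (sym (∑-words-shift _ ξ)) (∑-cong (words n) λ ζ → cong (λ c → ⟪ c ∧ a ⟫)
      (consistent-cong L (All.map (λ {p} eq → shift ζ p eq) sol)))
    where
    encoded : ∀ p → dot (lookup (Vec.map indicator f) p) ξ ≡ lookup b p →
        lookup (encode ξ) p ≡ lookup b p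
    encoded p eq rewrite lookup-encode ξ p with free p in fp
    -- The equation solved for the row of a free position says nothing about `encode`, which is zero
    -- there; agreement holds because `b` is zero there too.
    ... | true  = sym (b-free p fp)
    ... | false = trans (sym (dot-indicator (lookup f p) ξ))
        (trans (cong (λ v → dot v ξ) (sym (lookup-map p indicator f))) eq)
    shift : ∀ ζ p → dot (lookup (Vec.map indicator f) p) ξ ≡ lookup b p →
        lookup (encode (ζ ⊕ ξ)) p ≡ lookup (b ⊕ encode ζ) p
    shift ζ p eq = trans (encode-⊕ ζ ξ p) (trans (cong (lookup (encode ζ) p xor_) (encoded p eq))
      (trans (xor-comm (lookup (encode ζ) p) (lookup b p)) (sym (lookup-zipWith _xor_ p b (encode ζ)))))
  indistinguishable q ind b b-free (query p t₀ t₁) L le = begin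
    ∑ (words n) (λ ζ → ⟪ consistent L (encode ζ) ∧ run (query p t₀ t₁) (encode ζ) ⟫)
      ≡⟨ ∑-cong (words n) (λ ζ → split-query L p t₀ t₁ (encode ζ)) ⟩
    _ ≡⟨ ∑-+ (words n) _ _ ⟩
    _ ≡⟨ cong₂ _+_ (indistinguishable q ind b b-free t₀ ((p , false) ∷ L)
        (≤-trans (deeper (m≤m⊔n _ _)) le))
                   (indistinguishable q ind b b-free t₁ ((p , true) ∷ L)
                       (≤-trans (deeper (m≤n⊔m (depth t₀) _)) le)) ⟩
    _ ≡⟨ sym (∑-+ (words n) _ _) ⟩
    _ ≡⟨ sym (∑-cong (words n) (λ ζ → split-query L p t₀ t₁ (b ⊕ encode ζ))) ⟩
    ∑ (words n) (λ ζ → ⟪ consistent L (b ⊕ encode ζ) ∧ run (query p t₀ t₁) (b ⊕ encode ζ) ⟫) ∎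
    where
    open ≡-Reasoning
    deeper : ∀ {d} → d ≤ depth t₀ ⊔ depth t₁ → suc (length L) + d ≤ length L + suc (depth t₀ ⊔ depth t₁)
    deeper d≤ = ≤-trans (s≤s (+-monoʳ-≤ (length L) d≤)) (≤-reflexive (sym (+-suc (length L) _)))

  ⟪⟫≤1 : ∀ b → ⟪ b ⟫ ≤ 1
  ⟪⟫≤1 true  = ≤-refl
  ⟪⟫≤1 false = z≤n

  -- `repair (pad ζ)` is the member with free bits ζ; it shares every bound bit with `encode ζ`.
  hamming-encode : ∀ ζ → hamming (encode ζ) (repair (pad ζ)) ≤ n
  hamming-encode ζ = ≤-trans (≤-reflexive (hamming-∑ (encode ζ) (repair (pad ζ))))
      (≤-trans (∑-mono (allFin N) pointwise) #free)
    where
    pointwise : ∀ p → ⟪ lookup (encode ζ) p xor lookup (repair (pad ζ)) p ⟫ ≤ ⟪ free p ⟫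
    pointwise p rewrite lookup-repair (pad ζ) p | restrict-pad ζ with free p
    ... | true  = ⟪⟫≤1 _
    ... | false = ≤-reflexive (cong ⟪_⟫ (xor-same (lookup (encode ζ) p)))

  -- Clearing the free bits of the translation keeps the erased positions zero in both families, so
  -- queries there reveal nothing.
  bound-part : Word N → Word N
  bound-part w = tabulate λ p → if free p then false else lookup w p

  lookup-bound-part : ∀ w p → lookup (bound-part w) p ≡ (if free p then false else lookup w p)
  lookup-bound-part w = lookup∘tabulate _

  bound-part-free : ∀ w p → free p ≡ true → lookup (bound-part w) p ≡ false
  bound-part-free w p eq = trans (lookup-bound-part w p)
      (cong (λ c → if c then false else lookup w p) eq)

  member-bit : ∀ y → isMember y ≡ true → ∀ p → free p ≡ false →
      lookup (encode (restrict y)) p ≡ lookup y p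
  member-bit y y∈ p fp = equal
      (trans (sym (trans (violated≡ y p)
          (cong (λ c → if c then false else lookup y p xor lookup (encode (restrict y)) p) fp)))
      (zero-bit (n≤0⇒n≡0 (≤-trans (≤-∑ (λ p → ⟪ violated y p ⟫) p)
          (≤-reflexive (member⇒violations≡0 y y∈))))))
    where
    zero-bit : ∀ {b} → ⟪ b ⟫ ≡ 0 → b ≡ false
    zero-bit {false} _ = refl
    equal : ∀ {a c} → a xor c ≡ false → c ≡ a
    equal {false} eq = eq
    equal {true}  {true} _ = refl

  -- On bound positions a member y equals `encode (restrict y)`, and by linearity `encode ζ` can be
  -- moved across the comparison. Distance from the translate to y thus becomes distance from w to
  -- another codeword, up to the n free positions.
  hamming-translate : ∀ w ζ y → isMember y ≡ true →
    hamming w (encode (ζ ⊕ restrict y)) ≤ hamming (bound-part w ⊕ encode ζ) y + n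
  hamming-translate w ζ y y∈ = begin
    hamming w (encode (ζ ⊕ restrict y))     ≡⟨ hamming-∑ w (encode (ζ ⊕ restrict y)) ⟩
    ∑ (allFin N) apart                      ≤⟨ ∑-mono (allFin N) pointwise ⟩
    (∑[ p ∈ allFin N ] (near p + ⟪ free p ⟫)) ≡⟨ ∑-+ (allFin N) near (λ p → ⟪ free p ⟫) ⟩
    ∑ (allFin N) near + (∑[ p ∈ allFin N ] ⟪ free p ⟫)
      ≤⟨ +-mono-≤ (≤-reflexive (sym (hamming-∑ (bound-part w ⊕ encode ζ) y))) #free ⟩
    hamming (bound-part w ⊕ encode ζ) y + n ∎
    where
    open ≤-Reasoning
    apart near : Fin N → ℕ
    apart p = ⟪ lookup w p xor lookup (encode (ζ ⊕ restrict y)) p ⟫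
    near  p = ⟪ lookup (bound-part w ⊕ encode ζ) p xor lookup y p ⟫
    same-bit : ∀ p → free p ≡ false → lookup w p xor lookup (encode (ζ ⊕ restrict y)) p ≡
        lookup (bound-part w ⊕ encode ζ) p xor lookup y p
    same-bit p fp = trans (cong (lookup w p xor_)
        (trans (encode-⊕ ζ (restrict y) p) (cong (lookup (encode ζ) p xor_) (member-bit y y∈ p fp))))
      (trans (sym (xor-assoc (lookup w p) (lookup (encode ζ) p) (lookup y p)))
      (cong (_xor lookup y p) (sym (trans (lookup-zipWith _xor_ p (bound-part w) (encode ζ))
        (cong (_xor lookup (encode ζ) p)
            (trans (lookup-bound-part w p) (cong (λ c → if c then false else lookup w p) fp)))))))
    pointwise : ∀ p → apart p ≤ near p + ⟪ free p ⟫
    pointwise p = by-cases (free p) refl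
      where
      by-cases : ∀ c → free p ≡ c → apart p ≤ near p + ⟪ c ⟫
      by-cases true  _  = ≤-trans (⟪⟫≤1 _) (m≤n+m 1 (near p))
      by-cases false fp = ≤-trans (≤-reflexive (cong ⟪_⟫ (same-bit p fp))) (m≤m+n (near p) 0)

  total-accept : (A : RandAlg N) → Independent (queries A) (Vec.map indicator f) → ∀ w →
    ∑[ ζ ∈ words n ] #accept A (encode ζ) ≡ ∑[ ζ ∈ words n ] #accept A (bound-part w ⊕ encode ζ)
  total-accept A ind w = trans (exchange encode)
      (trans (∑-cong-All (toList A) (All.map tree (depth≤queries (toList A))))
    (sym (exchange (λ ζ → bound-part w ⊕ encode ζ))))
    where
    exchange : (g : Word n → Word N) → ∑[ ζ ∈ words n ] #accept A (g ζ) ≡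
        ∑[ t ∈ toList A ] ∑[ ζ ∈ words n ] ⟪ run t (g ζ) ⟫
    exchange g = trans (∑-cong (words n) λ ζ → length-accept (toList A) (g ζ))
        (∑-swap (words n) (toList A) λ ζ t → ⟪ run t (g ζ) ⟫)
    tree : ∀ {t} → depth t ≤ queries A →
        ∑[ ζ ∈ words n ] ⟪ run t (encode ζ) ⟫ ≡ ∑[ ζ ∈ words n ] ⟪ run t (bound-part w ⊕ encode ζ) ⟫
    tree {t} le = indistinguishable (queries A) ind (bound-part w) (bound-part-free w) t [] le
    ∑-cong-All : ∀ {X : Set} {g h : X → ℕ} (xs : List X) → All (λ x → g x ≡ h x) xs → ∑ xs g ≡ ∑ xs h
    ∑-cong-All []       []         = refl
    ∑-cong-All (x ∷ xs) (eq ∷ eqs) = cong₂ _+_ eq (∑-cong-All xs eqs)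

  -- Equal average acceptance would give the second family both acceptance and rejection at least
  -- 2/3 on average, a total of 4/3.
  not-both : (A : RandAlg N) (g h : Word n → Word N) →
    ∑[ ζ ∈ words n ] #accept A (g ζ) ≡ ∑[ ζ ∈ words n ] #accept A (h ζ) →
    (∀ ζ → AcceptsWHP A (g ζ)) → (∀ ζ → RejectsWHP A (h ζ)) → ⊥
  not-both A g h same accepts rejects = <⇒≱ positive (begin
    4 * (a * ws)                         ≡⟨ double a ws ⟩
    ws * (2 * a) + ws * (2 * a)
      ≡⟨ cong₂ _+_ (sym (∑-const (2 * a) (words n))) (sym (∑-const (2 * a) (words n))) ⟩
    (∑[ ζ ∈ words n ] 2 * a) + (∑[ ζ ∈ words n ] 2 * a)
      ≤⟨ +-mono-≤ (∑-mono (words n) accepts) (∑-mono (words n) rejects) ⟩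
    (∑[ ζ ∈ words n ] 3 * #accept A (g ζ)) + (∑[ ζ ∈ words n ] 3 * #reject A (h ζ))
      ≡⟨ cong₂ _+_ (∑-*ˡ 3 (words n) (λ ζ → #accept A (g ζ)))
          (∑-*ˡ 3 (words n) (λ ζ → #reject A (h ζ))) ⟩
    3 * (∑[ ζ ∈ words n ] #accept A (g ζ)) + 3 * rej
      ≡⟨ cong (λ s → 3 * s + 3 * rej) same ⟩
    3 * acc + 3 * rej                    ≡⟨ sym (*-distribˡ-+ 3 acc rej) ⟩
    3 * (acc + rej)
      ≡⟨ cong (3 *_) (sym (∑-+ (words n) (λ ζ → #accept A (h ζ)) (λ ζ → #reject A (h ζ)))) ⟩
    3 * (∑[ ζ ∈ words n ] (#accept A (h ζ) + #reject A (h ζ)))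
      ≡⟨ cong (3 *_) (trans (∑-cong (words n) (λ ζ → accept+reject A (h ζ))) (∑-const a (words n))) ⟩
    3 * (ws * a)                         ≡⟨ cong (3 *_) (*-comm ws a) ⟩
    3 * (a * ws) ∎)
    where
    open ≤-Reasoning
    a = length (toList A)
    ws = length (words n)
    acc = ∑[ ζ ∈ words n ] #accept A (h ζ)
    rej = ∑[ ζ ∈ words n ] #reject A (h ζ)
    double : ∀ a w → 4 * (a * w) ≡ w * (2 * a) + w * (2 * a)
    double = solve-∀
    aws>0 : 1 ≤ a * ws
    aws>0 = *-mono-≤ {1} {a} {1} {ws} (s≤s z≤n) (subst (1 ≤_) (sym (length-words n)) (m^n>0 2 n))
    positive : 3 * (a * ws) < 4 * (a * ws)
    positive = *-monoˡ-< (a * ws) {{>-nonZero aws>0}} {3} {4} ≤-refl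

  -- The translation vanishes on the free bits, so erasing the free bits (at most n errors)
  -- hides everything that separates the words encode ζ from their translates.
  no-distinguisher : ∀ (A : RandAlg N) → Independent (queries A) (Vec.map indicator f) → ∀ e →
      4 * e ≤ N → 8 * n < N →
    (∀ x y → isMember y ≡ true → hamming x y ≤ n → AcceptsWHP A x) →
    (∀ x → (∀ y → isMember y ≡ true → e < hamming x y + n) → RejectsWHP A x) → ⊥
  no-distinguisher A ind e 4e≤N 8n<N accepts rejects = conclude (far-word e 4e≤N 8n<N encode)
    where
    conclude : (∃ λ w → ∀ ζ → e < hamming w (encode ζ)) → ⊥
    conclude (w , far) = not-both A encode (λ ζ → bound-part w ⊕ encode ζ) (total-accept A ind w)
      (λ ζ → accepts (encode ζ) (repair (pad ζ)) (repair-member (pad ζ)) (hamming-encode ζ))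
      (λ ζ → rejects (bound-part w ⊕ encode ζ)
          (λ y y∈ → <-≤-trans (far (ζ ⊕ restrict y)) (hamming-translate w ζ y y∈)))

-- Rational thresholds as inequalities between naturals

module _ (a d : ℕ) .(co : Coprime a (suc d)) (N h : ℕ) where
  private
    ε = mkℚ (ℤ.+ a) d co

    product : toℚᵘ (ε ℚ.* ⟦ N ⟧) ℚᵘ.≃ mkℚᵘ (ℤ.+ (a * N)) d
    product = ℚᵘ.≃-trans (ℚ.toℚᵘ-homo-* ε ⟦ N ⟧) (ℚᵘ.≃-trans
      (ℚᵘ.*-congˡ {mkℚᵘ (ℤ.+ a) d} (ℚ.toℚᵘ-fromℚᵘ (mkℚᵘ (ℤ.+ N) 0)))
      (ℚᵘ.≃-reflexive (cong₂ mkℚᵘ (sym (ℤ.pos-* a N)) (cong pred (*-identityʳ (suc d))))))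

    numeral : toℚᵘ ⟦ h ⟧ ℚᵘ.≃ mkℚᵘ (ℤ.+ h) 0
    numeral = ℚ.toℚᵘ-fromℚᵘ (mkℚᵘ (ℤ.+ h) 0)

  ≤-scaled : h * suc d ≤ a * N → ⟦ h ⟧ ℚ.≤ ε ℚ.* ⟦ N ⟧
  ≤-scaled le = ℚ.toℚᵘ-cancel-≤ (ℚᵘ.≤-respʳ-≃ (ℚᵘ.≃-sym product) (ℚᵘ.≤-respˡ-≃ (ℚᵘ.≃-sym numeral)
    (ℚᵘ.*≤* (subst₂ ℤ._≤_ (ℤ.pos-* h (suc d)) (sym (ℤ.*-identityʳ (ℤ.+ (a * N)))) (+≤+ le)))))

  scaled-≤ : a * N ≤ h * suc d → ε ℚ.* ⟦ N ⟧ ℚ.≤ ⟦ h ⟧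
  scaled-≤ le = ℚ.toℚᵘ-cancel-≤ (ℚᵘ.≤-respˡ-≃ (ℚᵘ.≃-sym product) (ℚᵘ.≤-respʳ-≃ (ℚᵘ.≃-sym numeral)
    (ℚᵘ.*≤* (subst₂ ℤ._≤_ (sym (ℤ.*-identityʳ (ℤ.+ (a * N)))) (ℤ.pos-* h (suc d)) (+≤+ le)))))

  scaled-< : a * N < h * suc d → ε ℚ.* ⟦ N ⟧ ℚ.< ⟦ h ⟧
  scaled-< lt = ℚ.≰⇒> λ le → <⇒≱ lt (≤-scaled⁻¹ le)
    where
    ≤-scaled⁻¹ : ⟦ h ⟧ ℚ.≤ ε ℚ.* ⟦ N ⟧ → h * suc d ≤ a * N
    ≤-scaled⁻¹ le with ℚᵘ.≤-respʳ-≃ product (ℚᵘ.≤-respˡ-≃ numeral (ℚ.toℚᵘ-mono-≤ le))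
    ... | ℚᵘ.*≤* le′ = ℤ.drop‿+≤+
        (subst₂ ℤ._≤_ (sym (ℤ.pos-* h (suc d))) (ℤ.*-identityʳ (ℤ.+ (a * N))) le′)

  scaled-<⁻¹ : ε ℚ.* ⟦ N ⟧ ℚ.< ⟦ h ⟧ → a * N < h * suc d
  scaled-<⁻¹ lt = ≰⇒> λ le → ℚ.<-irrefl refl (ℚ.<-≤-trans lt (≤-scaled le))

hamming≡0 : ∀ {N} (x y : Word N) → hamming x y ≡ 0 → x ≡ y
hamming≡0 []          []          _  = refl
hamming≡0 (false ∷ x) (false ∷ y) eq = cong (false ∷_) (hamming≡0 x y eq)
hamming≡0 (true ∷ x)  (true ∷ y)  eq = cong (true ∷_) (hamming≡0 x y eq)

-- Growth of the iterated logarithm and choice of parameters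

n<2^n : ∀ n → n < 2 ^ n
n<2^n zero    = s≤s z≤n
n<2^n (suc n) = +-mono-≤ (m^n>0 2 n) (≤-trans (n<2^n n) (m≤m+n _ 0))

⌊log₂n⌋≤n : ∀ n → ⌊log₂ n ⌋ ≤ n
⌊log₂n⌋≤n n = ≤-trans (⌊log₂⌋-mono-≤ (<⇒≤ (n<2^n n))) (≤-reflexive (⌊log₂[2^n]⌋≡n n))

ilog-unbounded : ∀ ℓ m → ∃ λ N₀ → ∀ N → N₀ ≤ N → m ≤ ilog ℓ N
ilog-unbounded zero    m = m , λ N le → le
ilog-unbounded (suc ℓ) m with N₀ , large ← ilog-unbounded ℓ (2 ^ m) =
  N₀ , λ N le → ≤-trans (≤-reflexive (sym (⌊log₂[2^n]⌋≡n m))) (⌊log₂⌋-mono-≤ (large N le))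

module _ (ℓ : ℕ) where

  -- Two properties matter: it is unbounded, so n = o(N), and at most `ilog ℓ N + 2`, so its square
  -- is absorbed by the polylogarithm. The two successors keep it at least 2, which `#bits≤` uses.
  ratio : ℕ → ℕ
  ratio N = suc (suc (ilog (suc ℓ) N))

  -- The successor makes n positive and compensates the floor, so that n · ratio is at least N.
  #bits : ℕ → ℕ
  #bits N = suc (N / ratio N)

  #bits≤ : ∀ k → #bits (suc k) ≤ suc k
  #bits≤ k = m/n<m (suc k) (ratio (suc k)) (s≤s (s≤s z≤n))

  -- Abstract, since unfolding would run the exhaustive search for the rows.
  abstract
    system : ∀ k → Vec (Row (#bits (suc k))) (suc k)
    system k = proj₁ (independent-rows-exist (#bits (suc k)) (suc k))

    system-independent : ∀ k q → 32 * suc k * q ≤ #bits (suc k) * #bits (suc k) →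
      Independent q (Vec.map indicator (system k))
    system-independent k = independent-indicators (system k)
        (proj₂ (independent-rows-exist (#bits (suc k)) (suc k)))

  module System k = Code (#bits≤ k) (system k)

  Q : Property
  Q = record
    { defined = λ { zero → false ; (suc _) → true }
    ; member  = λ { zero _ → true ; (suc k) x → System.isMember k x }
    }

  infinitely-many-lengths : InfinitelyManyLengths Q
  infinitely-many-lengths m = suc m , n≤1+n m , refl

  tester : ∀ ε → 0ℚ ℚ.< ε → ε ℚ.< 1ℚ → ∃ λ q → ∀ N → defined Q N ≡ true →
    ∃ λ (A : RandAlg N) → (queries A ≤ q) × IsTester Q N 0ℚ ε A
  tester (mkℚ (ℤ.+ zero) _ _) (*<* (+<+ ()))
  tester (mkℚ -[1+ _ ] _ _) (*<* ())
  -- A positive ε is at least the reciprocal of its denominator `suc c`, so `c` alone fixes the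
  -- number of trials.
  tester ε@(mkℚ (ℤ.+ suc a) c co) _ _ = suc (2 * c) * 5 , at
    where
    at : ∀ N → defined Q N ≡ true → ∃ λ (A : RandAlg N) →
        (queries A ≤ suc (2 * c) * 5) × IsTester Q N 0ℚ ε A
    at (suc k) _ = package (System.property-tester k c)
      where
      exact : ∀ x → DistLE Q (suc k) x 0ℚ → System.isMember k x ≡ true
      exact x (y , y∈ , le) = subst (λ z → System.isMember k z ≡ true) (sym (hamming≡0 x y h≡0)) y∈
        where
        h≡0 : hamming x y ≡ 0
        h≡0 = n≤0⇒n≡0 (≮⇒≥ λ 0<h →
            ℚ.<-irrefl refl (ℚ.<-≤-trans
                (scaled-< 0 0 _ (suc k) (hamming x y)
                    (≤-trans 0<h (≤-reflexive (sym (*-identityʳ _))))) le))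
      package : (∃ λ (A : RandAlg (suc k)) → (queries A ≤ suc (2 * c) * 5) ×
          (∀ x → System.isMember k x ≡ true → AcceptsWHP A x) ×
          (∀ x → (∀ y → System.isMember k y ≡ true → suc k ≤ suc c * hamming x y) → RejectsWHP A x)) →
        ∃ λ (A : RandAlg (suc k)) → (queries A ≤ suc (2 * c) * 5) × IsTester Q (suc k) 0ℚ ε A
      package (A , few , accepts , rejects) = A , few , (λ x near → accepts x (exact x near)) ,
          λ x far → rejects x λ y y∈ →
            <⇒≤ (≤-<-trans (m≤n*m (suc k) (suc a))
              (<-≤-trans (scaled-<⁻¹ (suc a) c co (suc k) (hamming x y) (far y y∈))
                (≤-reflexive (*-comm (hamming x y) (suc c)))))

  N≤ratio*#bits : ∀ N → N ≤ ratio N * #bits N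
  N≤ratio*#bits N = begin
    N                               ≡⟨ m≡m%n+[m/n]*n N (ratio N) ⟩
    N % ratio N + N / ratio N * ratio N  ≤⟨ +-monoˡ-≤ _ (<⇒≤ (m%n<n N (ratio N))) ⟩
    #bits N * ratio N               ≡⟨ *-comm (#bits N) (ratio N) ⟩
    ratio N * #bits N ∎
    where open ≤-Reasoning

  #bits-sublinear : ∀ b → ∃ λ N₀ → ∀ N → N₀ ≤ N → b * #bits N ≤ N
  #bits-sublinear b with N₁ , large ← ilog-unbounded (suc ℓ) (2 * b) =
    -- One half of N pays for the quotient, once the ratio exceeds 2b, and the other half for the
    -- rounding successor.
    N₁ + 2 * b , λ N le → *-cancelˡ-≤ 2 (begin
      2 * (b * suc (N / ratio N))           ≡⟨ expand b (N / ratio N) ⟩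
      N / ratio N * (2 * b) + 2 * b
        ≤⟨ +-mono-≤ (*-monoʳ-≤ (N / ratio N)
            (≤-trans (large N (m+n≤o⇒m≤o N₁ le)) (≤-trans (n≤1+n _) (n≤1+n _)))) (m+n≤o⇒n≤o N₁ le) ⟩
      N / ratio N * ratio N + N             ≤⟨ +-monoˡ-≤ N (m/n*n≤m N (ratio N)) ⟩
      N + N                                 ≡⟨ double N ⟩
      2 * N ∎)
    where
    open ≤-Reasoning
    expand : ∀ b m → 2 * (b * suc m) ≡ m * (2 * b) + 2 * b
    expand = solve-∀
    double : ∀ m → m + m ≡ 2 * m
    double = solve-∀

  lower-bound : ∀ ε₀ → 0ℚ ℚ.< ε₀ → TolerantLowerBound ℓ Q ε₀ (ℤ.+ 1 ℚ./ 16)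
  lower-bound (mkℚ (ℤ.+ zero) _ _) (*<* (+<+ ()))
  lower-bound (mkℚ -[1+ _ ] _ _) (*<* ())
  -- The factor `suc d` makes n at most ε₀N, since ε₀ is at least 1/(d+1); the factor 16 makes n at
  -- most N/16, for the far word and for ε₁.
  lower-bound ε₀@(mkℚ (ℤ.+ suc a) d co) _ with N₀ , sublinear ← #bits-sublinear (16 * suc d) =
    ℤ.+ 1 ℚ./ 32 , 2 , N₀ , *<* (+<+ (s≤s z≤n)) , at
    where
    at : ∀ N → N₀ ≤ N → defined Q N ≡ true → (A : RandAlg N) → IsTester Q N ε₀ (ℤ.+ 1 ℚ./ 16) A →
      ℤ.+ 1 ℚ./ 32 ℚ.* ⟦ N ⟧ ℚ.≤ ⟦ queries A * (10 ^ ℓ) * ((ilog ℓ N + 2) ^ 2) ⟧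
    at N@(suc k) N₀≤N _ A (accepts , rejects) = scaled-≤ 1 31 _ N (q * 10 ^ ℓ * (ilog ℓ N + 2) ^ 2)
      (≤-trans (≤-reflexive (*-identityˡ N)) (enough (32 * N * q ≤? b * b)))
      where
      open ≤-Reasoning
      b = #bits N
      q = queries A
      t = ratio N
      small : 16 * suc d * b ≤ N
      small = sublinear N N₀≤N
      16n≤N : 16 * b ≤ N
      16n≤N = ≤-trans (*-monoˡ-≤ b (m≤m*n 16 (suc d))) small
      dn≤N : suc d * b ≤ N
      dn≤N = ≤-trans (*-monoˡ-≤ b (m≤n*m (suc d) 16)) small
      8n<N : 8 * b < N
      8n<N = <-≤-trans (*-monoˡ-< b {8} {16} (s≤s (m≤n+m 8 7))) 16n≤N
      4⌊N/4⌋≤N : 4 * (N / 4) ≤ N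
      4⌊N/4⌋≤N = ≤-trans (≤-reflexive (*-comm 4 (N / 4))) (m/n*n≤m N 4)
      close : ∀ h → h ≤ b → ⟦ h ⟧ ℚ.≤ ε₀ ℚ.* ⟦ N ⟧
      close h h≤n = ≤-scaled (suc a) d co N h (begin
        h * suc d   ≤⟨ *-monoˡ-≤ (suc d) h≤n ⟩
        b * suc d   ≡⟨ *-comm b (suc d) ⟩
        suc d * b   ≤⟨ dn≤N ⟩
        N           ≤⟨ m≤n*m N (suc a) ⟩
        suc a * N ∎)
      -- From N/4 < h + n and n ≤ N/16 one gets h > 3N/16, well beyond the threshold N/16, even with
      -- the floor in `N / 4`.
      distant : ∀ h → N / 4 < h + b → ℤ.+ 1 ℚ./ 16 ℚ.* ⟦ N ⟧ ℚ.< ⟦ h ⟧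
      distant h lt = scaled-< 1 15 _ N h (+-cancelʳ-< (3 * N) _ _ (begin-strict
        1 * N + 3 * N                 ≡⟨ four N ⟩
        4 * N                         ≡⟨ cong (4 *_) (m≡m%n+[m/n]*n N 4) ⟩
        4 * (N % 4 + N / 4 * 4)       <⟨ *-monoʳ-< 4 (+-monoˡ-< (N / 4 * 4) (m%n<n N 4)) ⟩
        4 * (4 + N / 4 * 4)           ≡⟨ sixteen (N / 4) ⟩
        16 * suc (N / 4)              ≤⟨ *-monoʳ-≤ 16 lt ⟩
        16 * (h + b)                  ≡⟨ spread h b ⟩
        h * 16 + 16 * b               ≤⟨ +-monoʳ-≤ (h * 16) (≤-trans 16n≤N (m≤n*m N 3)) ⟩
        h * 16 + 3 * N ∎))
        where
        four : ∀ N → 1 * N + 3 * N ≡ 4 * N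
        four = solve-∀
        sixteen : ∀ m → 4 * (4 + m * 4) ≡ 16 * suc m
        sixteen = solve-∀
        spread : ∀ h b → 16 * (h + b) ≡ h * 16 + 16 * b
        spread = solve-∀
      enough : Dec (32 * N * q ≤ b * b) → N ≤ q * 10 ^ ℓ * (ilog ℓ N + 2) ^ 2 * 32
      enough (yes le) = contradiction
        (system-independent k q le)
        λ ind → System.no-distinguisher k A ind (N / 4) 4⌊N/4⌋≤N 8n<N
          (λ x y y∈ h≤n → accepts x (y , y∈ , close (hamming x y) h≤n))
          (λ x far → rejects x (λ y y∈ → distant (hamming x y) (far y y∈)))
      -- Now n² < 32Nq. Since N ≤ ratio · n, squaring gives N² ≤ ratio² · 32Nq, and one factor N
      -- cancels.
      enough (no ≰) = *-cancelˡ-≤ N (begin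
        N * N                                    ≤⟨ *-mono-≤ (N≤ratio*#bits N) (N≤ratio*#bits N) ⟩
        t * b * (t * b)                          ≡⟨ square t b ⟩
        t * t * (b * b)                          ≤⟨ *-monoʳ-≤ (t * t) (<⇒≤ (≰⇒> ≰)) ⟩
        t * t * (32 * N * q)
          ≤⟨ *-mono-≤ (*-mono-≤ t≤ t≤) (*-monoʳ-≤ (32 * N) (m≤m*n q (10 ^ ℓ) {{m^n≢0 10 ℓ}})) ⟩
        (ilog ℓ N + 2) * (ilog ℓ N + 2) * (32 * N * (q * 10 ^ ℓ))
          ≡⟨ collect N (q * 10 ^ ℓ) (ilog ℓ N + 2) ⟩
        N * (q * 10 ^ ℓ * (ilog ℓ N + 2) ^ 2 * 32) ∎)
        where
        t≤ : t ≤ ilog ℓ N + 2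
        t≤ = ≤-trans (s≤s (s≤s (⌊log₂n⌋≤n (ilog ℓ N)))) (≤-reflexive (+-comm 2 (ilog ℓ N)))
        square : ∀ t b → t * b * (t * b) ≡ t * t * (b * b)
        square = solve-∀
        collect : ∀ N q t → t * t * (32 * N * q) ≡ N * (q * (t * (t * 1)) * 32)
        collect = solve-∀

theorem6p1 : ∀ (ℓ : ℕ) → ∃ λ (Q : Property) → ∃ λ (ε₁ : ℚ) →
    InfinitelyManyLengths Q × (0ℚ ℚ.< ε₁) × (ε₁ ℚ.< 1ℚ) ×
    (∀ (ε : ℚ) → 0ℚ ℚ.< ε → ε ℚ.< 1ℚ → ∃ λ (q : ℕ) →
       ∀ N → defined Q N ≡ true → ∃ λ (A : RandAlg N) → (queries A ℕ.≤ q) × IsTester Q N 0ℚ ε A) ×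
    (∀ (ε₀ : ℚ) → 0ℚ ℚ.< ε₀ → ε₀ ℚ.< ε₁ → TolerantLowerBound ℓ Q ε₀ ε₁)
theorem6p1 ℓ = Q ℓ , ℤ.+ 1 ℚ./ 16 , infinitely-many-lengths ℓ ,
  *<* (+<+ (s≤s z≤n)) , *<* (+<+ (s≤s (s≤s z≤n))) , tester ℓ , λ ε₀ 0<ε₀ _ → lower-bound ℓ ε₀ 0<ε₀
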